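{- Let $n\ge 4$ be an even integer. Then $$r_{\mathrm{odd}}(n,n/2+2;C_n)\ge 3.$$
   Context: All graphs are finite and simple; $v(G)$ is the number of vertices and $\delta(G)$ the minimum degree of $G$. An $r$-coloring of a graph $G$ is a map $\chi:E(G)\to[r]=\{1,\dots,r\}$ (not necessarily proper or surjective). $C_n$ is the cycle on $n$ vertices, so a copy of $C_n$ in an $n$-vertex graph is a Hamilton cycle. For graphs $G,H$, the odd-Ramsey number $r_{\mathrm{odd}}(G,H)$ is the minimum positive integer $r$ for which there is an $r$-coloring of $G$ such that in every (not necessarily induced) copy of $H$ in $G$ some color occurs on an odd number of edges of that copy. For even $n\ge4$ and an integer $d$, define $$r_{\mathrm{odd}}(n,d;C_n)=\min\{r_{\mathrm{odd}}(G,C_n): v(G)=n,\ \delta(G)\ge d\},$$ where the minimum over an empty family is $+\infty$ (this occurs here only for $n=4$, as no $4$-vertex graph has minimum degree at least $4$). -}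

module Defs where

open import Data.Bool using (Bool; T)
open import Data.Bool.Properties using (T?)
open import Data.Fin as Fin using (Fin; toℕ)
import Data.Fin.Properties as Fin
open import Data.Fin.Subset using (Subset; ∣_∣)
open import Data.List using (List; mapMaybe; map; filter; length; allFin; cartesianProduct)
open import Data.List.Extrema.Nat using (min)
import Data.Maybe as Maybe
open import Data.Nat using (ℕ; suc; _≤_; _≟_; ∣_-_∣)
open import Data.Nat.Divisibility using (_∣_)
open import Data.Nat.Properties using (∣-∣-comm)
open import Data.Product using (Σ; Σ-syntax; _×_; _,_)
open import Data.Sum using (_⊎_)
open import Data.Vec using (tabulate)
open import Function using (_∘_)
open import Function.Definitions using (Injective)
open import Relation.Binary.PropositionalEquality using (_≡_; _≢_; refl; sym; subst)
open import Relation.Nullary using (Dec; ¬_; ¬?; ⌊_⌋; dec⇒maybe; toWitness; fromWitness; _×-dec_; _⊎-dec_)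
open import Relation.Nullary.Construct.Add.Supremum using (_⁺; ⊤⁺; [_])

record Graph (n : ℕ) : Set where
  field
    adj      : Fin n → Fin n → Bool
    symm     : ∀ {u v} → T (adj u v) → T (adj v u)
    loopless : ∀ {v} → ¬ T (adj v v)

  Adj : Fin n → Fin n → Set
  Adj u v = T (adj u v)

  neighbours : Fin n → Subset n
  neighbours v = tabulate (adj v)

  degree : Fin n → ℕ
  degree v = ∣ neighbours v ∣

  -- The default value n exceeds every degree, so for n ≥ 1 it never affects
  -- the minimum.
  δ : ℕ
  δ = min n (map degree (allFin n))

  -- An unordered edge is represented by its increasing pair of endpoints.
  IsEdge : Fin n × Fin n → Set
  IsEdge (u , v) = u Fin.< v × Adj u v

  isEdge? : ∀ p → Dec (IsEdge p)
  isEdge? (u , v) = (u Fin.<? v) ×-dec T? (adj u v)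

  Edge : Set
  Edge = Σ (Fin n × Fin n) IsEdge

  edges : List Edge
  edges = mapMaybe (λ p → Maybe.map (p ,_) (dec⇒maybe (isEdge? p)))
                   (cartesianProduct (allFin n) (allFin n))

open Graph

-- A map on unordered edges is given as a symmetric map on ordered pairs of
-- adjacent vertices.  As Adj is proof-irrelevant, the colour depends on the
-- endpoints only.
record Coloring {n : ℕ} (G : Graph n) (r : ℕ) : Set where
  field
    color      : ∀ u v → Adj G u v → Fin r
    color-symm : ∀ {u v} (p : Adj G u v) (q : Adj G v u) → color u v p ≡ color v u q

open Coloring

-- A copy of H in G is given by an embedding of H; the copy itself is the image
-- of that embedding, whose edges correspond bijectively to the edges of H.
record Copy {m n : ℕ} (H : Graph m) (G : Graph n) : Set where
  field
    φ         : Fin m → Fin n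
    injective : Injective _≡_ _≡_ φ
    preserves : ∀ {u v} → Adj H u v → Adj G (φ u) (φ v)

  edgeColor : ∀ {r} → Coloring G r → Edge H → Fin r
  edgeColor χ ((u , v) , _ , uv) = color χ (φ u) (φ v) (preserves uv)

  occurrences : ∀ {r} → Coloring G r → Fin r → ℕ
  occurrences χ c = length (filter (λ e → edgeColor χ e Fin.≟ c) (edges H))

open Copy

HasOddColor : ∀ {m n r} {H : Graph m} {G : Graph n} → Coloring G r → Copy H G → Set
HasOddColor {r = r} χ K = Σ[ c ∈ Fin r ] ¬ (2 ∣ occurrences K χ c)

OddColorable : ∀ {m n} → Graph n → Graph m → ℕ → Set
OddColorable G H r = Σ[ χ ∈ Coloring G r ] ((K : Copy H G) → HasOddColor χ K)

-- The minimum of a set of natural numbers, with min ∅ = +∞.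
IsMin : (ℕ → Set) → ℕ ⁺ → Set
IsMin P [ k ] = P k × (∀ j → P j → k ≤ j)
IsMin P ⊤⁺    = ∀ j → ¬ P j

-- r is the value of r_odd(G,H).
IsROdd : ∀ {m n} → Graph n → Graph m → ℕ ⁺ → Set
IsROdd G H r = IsMin (λ s → 1 ≤ s × OddColorable G H s) r

-- r is the value of r_odd(n,d;H).  Members of the family with r_odd(G,H) = +∞
-- (possible only if H has no edges) do not affect the minimum and are omitted.
IsMinROdd : ∀ {m} (n d : ℕ) → Graph m → ℕ ⁺ → Set
IsMinROdd n d H r = IsMin (λ s → Σ[ G ∈ Graph n ] (d ≤ δ G × IsROdd G H [ s ])) r

-- The cycle 0, 1, …, n-1, 0, for n ≥ 3.  The condition i ≢ j matters only for
-- n = 1, where it excludes a loop.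
CycleAdj : ∀ {n} → Fin n → Fin n → Set
CycleAdj {n} i j = i ≢ j × (∣ toℕ i - toℕ j ∣ ≡ 1 ⊎ suc ∣ toℕ i - toℕ j ∣ ≡ n)

cycleAdj? : ∀ {n} (i j : Fin n) → Dec (CycleAdj i j)
cycleAdj? {n} i j =
  ¬? (i Fin.≟ j) ×-dec ((∣ toℕ i - toℕ j ∣ ≟ 1) ⊎-dec (suc ∣ toℕ i - toℕ j ∣ ≟ n))

cycleAdj-symm : ∀ {n} (i j : Fin n) → CycleAdj i j → CycleAdj j i
cycleAdj-symm {n} i j (i≢j , d) =
  (i≢j ∘ sym) , subst (λ k → k ≡ 1 ⊎ suc k ≡ n) (∣-∣-comm (toℕ i) (toℕ j)) d

C : (n : ℕ) → Graph n
C n = record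
  { adj      = λ i j → ⌊ cycleAdj? i j ⌋
  ; symm     = λ {i} {j} → fromWitness {a? = cycleAdj? j i} ∘ cycleAdj-symm i j
                         ∘ toWitness {a? = cycleAdj? i j}
  ; loopless = λ {i} p → let (i≢i , _) = toWitness {a? = cycleAdj? i i} p in i≢i refl
  }

{-# OPTIONS --safe #-}

-- Let w be the indicator of one of at most two colours, with values in 𝔽₂, and suppose that
-- w has the same sum on all Hamilton cycles; this common value turns out to be 0, so some
-- Hamilton cycle has no odd colour.  If every vertex outside R has at most k neighbours in R,
-- where 2k ≤ |R| + 3, then Ore's condition survives in G - R, so any two vertices a, b of
-- G - R are joined by a Hamilton path of G - R.  Hence any two paths from a to b whose sets of
-- inner vertices are R have the same weight.  Applied to
--   (1) b y c x a and b x c y a, with c a common neighbour of x and y (k = 3),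
--   (2) a v a′ z b b′ and a a′ z b v b′, with z a common neighbour of a′ and b, where no vertex
--       is adjacent to all of v, a′, b (k = 3),
--   (3) h₄ h₃ d h₅ h₁ h₂ c and h₄ h₅ d h₃ h₂ h₁ c, for an induced pentagon h₁ … h₅, where no
--       vertex is adjacent to all of h₁, h₂, h₃, h₅ (k = 4),
-- this shows in turn that 4-cycles have weight 0, that all triangles have the same weight τ,
-- and that pentagons have weight τ; the excluded cases reduce to shorter cycles.  Fixing v and
-- putting f x = w v a + w a x for a common neighbour a of v and x, the pentagons v a x y b give
-- w x y = τ + f x + f y on all edges, and this sums to 0 over a cycle of even length.

module Submission where

open import Defs
open import Data.Bool using (Bool; true; false; not; T; if_then_else_; _∧_; _xor_)
open import Data.Bool.Properties
  using (T?; T-irrelevant; xor-same; xor-identityʳ; not-involutive; ∧-assoc)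
open import Data.Bool.Solver using (module xor-∧-Solver)
open import Data.Empty using (⊥-elim)
open import Data.Fin as Fin using (Fin; zero; suc; toℕ)
open import Data.Fin.Properties using (any?; toℕ<n; toℕ-injective)
open import Data.Fin.Subset using (∣_∣)
open import Data.List
  using (List; []; _∷_; _++_; length; map; filter; mapMaybe; tabulate; allFin; cartesianProduct)
open import Data.List.Extrema.Nat using (min≤v⁺)
open import Data.List.Membership.Propositional using (_∈_; _∉_; lose)
open import Data.List.Membership.Propositional.Properties
  using (∈-∃++; ∈-++⁻; ∈-++⁺ˡ; ∈-++⁺ʳ; ∈-map⁺; ∈-allFin)
open import Data.List.Properties using (++-assoc; ++-identityʳ; length-++; length-tabulate)
open import Data.List.Relation.Binary.Permutation.Propositional
  using (_↭_; ↭-refl; ↭-sym; ↭-trans; ↭-reflexive; ↭⇒↭ₛ; prep; swap; module PermutationReasoning)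
import Data.List.Relation.Binary.Permutation.Propositional as Perm
open import Data.List.Relation.Binary.Permutation.Propositional.Properties
  using (↭-length; ++⁺; ++⁺ˡ; ++⁺ʳ; ++-comm; shift; ∈-resp-↭)
import Data.List.Relation.Binary.Permutation.Setoid.Properties as PermSetoid
open import Data.List.Relation.Unary.All as All using ([]; _∷_)
open import Data.List.Relation.Unary.AllPairs using ([]; _∷_)
open import Data.List.Relation.Unary.Any using (here; there)
open import Data.List.Relation.Unary.Unique.Propositional using (Unique)
open import Data.List.Relation.Unary.Unique.Propositional.Properties using (allFin⁺)
open import Data.Maybe as Maybe using (Maybe; just; nothing; maybe′)
open import Data.Nat
  using (ℕ; zero; suc; _+_; _/_; _≤_; _<_; z≤n; s≤s; z<s; _≟_; _<?_; _≡ᵇ_; _<ᵇ_; ∣_-_∣)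
open import Data.Nat.Divisibility using (_∣_; divides)
open import Data.Nat.DivMod using (m*n/n≡m)
open import Data.Nat.Induction using (<-wellFounded)
open import Data.Nat.Properties
  using (*-comm; +-assoc; +-cancelˡ-≤; +-comm; +-identityʳ; +-mono-≤; +-monoʳ-<; +-monoʳ-≤; +-monoˡ-≤
        ; +-suc; <-asym; <-irrefl; <-trans; <⇒≢; m≤m+n; m≤n+m; n<1+n; n≤1+n; n≮0; ∣m-n∣≤m⊔n; ≤-<-trans
        ; ≤-pred; ≤-refl; ≤-trans; ≮⇒≥; ⊔-pres-<m; module ≤-Reasoning)
open import Data.Nat.Solver using (module +-*-Solver)
open import Data.Product using (Σ-syntax; ∃; ∃₂; _×_; _,_; proj₁; proj₂)
open import Data.Sum using (_⊎_; inj₁; inj₂)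
open import Data.Unit using (⊤; tt)
open import Function using (_∘_; case_of_; id)
open import Induction.WellFounded using (Acc; acc)
open import Relation.Binary.PropositionalEquality
  using (_≡_; _≢_; refl; sym; ≢-sym; trans; cong; cong₂; subst; subst₂; setoid; module ≡-Reasoning)
open import Relation.Nullary
  using (¬_; Dec; yes; no; does; _×-dec_; _⊎-dec_; dec⇒maybe; toWitness; fromWitness)
open import Relation.Nullary.Decidable using (dec-true; dec-false)
open import Relation.Unary using (Decidable)
open import Relation.Nullary.Construct.Add.Supremum using (_⁺; ⊤⁺; [_])
open import Relation.Binary.Construct.Add.Supremum.NonStrict _≤_ using (_≤⁺_; [_]; _≤⊤⁺)
import Data.Vec as Vec

-- Counting in lists.

ind : Bool → ℕ
ind b = if b then 1 else 0

ind≤1 : ∀ b → ind b ≤ 1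
ind≤1 true  = ≤-refl
ind≤1 false = z≤n

¬T⇒ind≡0 : ∀ {b} → ¬ T b → ind b ≡ 0
¬T⇒ind≡0 {true}  ¬t = ⊥-elim (¬t tt)
¬T⇒ind≡0 {false} _  = refl

module _ {A : Set} where

  count : (A → Bool) → List A → ℕ
  count p []       = 0
  count p (x ∷ xs) = ind (p x) + count p xs

  count-++ : ∀ p xs ys → count p (xs ++ ys) ≡ count p xs + count p ys
  count-++ p []       ys = refl
  count-++ p (x ∷ xs) ys =
    trans (cong (ind (p x) +_) (count-++ p xs ys)) (sym (+-assoc (ind (p x)) _ _))

  count-↭ : ∀ p {xs ys} → xs ↭ ys → count p xs ≡ count p ys
  count-↭ p Perm.refl           = refl
  count-↭ p (prep x xs↭ys)      = cong (ind (p x) +_) (count-↭ p xs↭ys)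
  count-↭ p (swap x y xs↭ys)
    rewrite count-↭ p xs↭ys     =
    solve 3 (λ a b c → a :+ (b :+ c) := b :+ (a :+ c)) refl (ind (p x)) (ind (p y)) _
    where open +-*-Solver
  count-↭ p (Perm.trans q r)    = trans (count-↭ p q) (count-↭ p r)

  count≤length : ∀ p xs → count p xs ≤ length xs
  count≤length p []       = z≤n
  count≤length p (x ∷ xs) = +-mono-≤ (ind≤1 (p x)) (count≤length p xs)

  count<length : ∀ p {x} xs → x ∈ xs → ¬ T (p x) → count p xs < length xs
  count<length p (x ∷ xs) (here refl) ¬px rewrite ¬T⇒ind≡0 ¬px = s≤s (count≤length p xs)
  count<length p (x ∷ xs) (there x∈xs) ¬px =
    subst (_≤ suc (length xs)) (+-suc (ind (p x)) _)
      (+-mono-≤ (ind≤1 (p x)) (count<length p xs x∈xs ¬px))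

  pigeonhole : ∀ p q xs → length xs < count p xs + count q xs →
               ∃ λ x → x ∈ xs × T (p x) × T (q x)
  pigeonhole p q (x ∷ xs) h with p x in px | q x in qx
  ... | true | true = x , here refl , subst T (sym px) tt , subst T (sym qx) tt
  ... | true | false =
    let y , y∈ , py , qy = pigeonhole p q xs (≤-pred h) in y , there y∈ , py , qy
  ... | false | true =
    let y , y∈ , py , qy = pigeonhole p q xs
          (≤-pred (subst (suc (suc (length xs)) ≤_) (+-suc (count p xs) _) h))
    in y , there y∈ , py , qy
  ... | false | false =
    let y , y∈ , py , qy = pigeonhole p q xs (<-trans (n<1+n _) h) in y , there y∈ , py , qy

  extract : ∀ {xs : List A} ys → Unique ys → (∀ {y} → y ∈ ys → y ∈ xs) → ∃ λ zs → ys ++ zs ↭ xs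
  extract {xs} []       _        _     = xs , ↭-refl
  extract (y ∷ ys) (y≢ys ∷ uys) ys⊆xs with ∈-∃++ (ys⊆xs (here refl))
  ... | as , bs , refl =
    let zs , p = extract ys uys ys⊆as++bs
    in zs , ↭-trans (prep y p) (↭-sym (shift y as bs))
    where
    ys⊆as++bs : ∀ {z} → z ∈ ys → z ∈ as ++ bs
    ys⊆as++bs z∈ys with ∈-++⁻ as (ys⊆xs (there z∈ys))
    ... | inj₁ z∈as         = ∈-++⁺ˡ z∈as
    ... | inj₂ (here refl)  = ⊥-elim (All.lookup y≢ys z∈ys refl)
    ... | inj₂ (there z∈bs) = ∈-++⁺ʳ as z∈bs

-- Routes: vertex sequences with prescribed ends.

infixr 5 _∷_

-- A nonempty list with its two ends in the type, so that rerouting visibly keeps the ends.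
-- Adjacency of consecutive entries is left to `Path`, because the descent below starts from an
-- arbitrary ordering of the vertices.
data Route {A : Set} : A → A → Set where
  ⟨_⟩ : ∀ x → Route x x
  _∷_ : ∀ x {y z} → Route y z → Route x z

module _ {A : Set} where

  private variable
    a b c d s t x y z : A

  infixr 5 _⊕_

  toList : Route a b → List A
  toList ⟨ x ⟩   = x ∷ []
  toList (x ∷ r) = x ∷ toList r

  -- The end of the first route and the start of the second stay separate entries: the join adds a
  -- step from `b` to `c`.
  _⊕_ : Route a b → Route c d → Route a d
  ⟨ x ⟩   ⊕ s = x ∷ s
  (x ∷ r) ⊕ s = x ∷ (r ⊕ s)

  rev : Route a b → Route b a
  rev ⟨ x ⟩   = ⟨ x ⟩
  rev (x ∷ r) = rev r ⊕ ⟨ x ⟩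

  head∈ : (r : Route a b) → a ∈ toList r
  head∈ ⟨ x ⟩   = here refl
  head∈ (x ∷ r) = here refl

  last∈ : (r : Route a b) → b ∈ toList r
  last∈ ⟨ x ⟩   = here refl
  last∈ (x ∷ r) = there (last∈ r)

  pairs : Route a b → List (A × A)
  pairs ⟨ x ⟩             = []
  pairs (_∷_ x {y} r)  = (x , y) ∷ pairs r

  route : ∀ a (xs : List A) b → Route a b
  route a []       b = a ∷ ⟨ b ⟩
  route a (x ∷ xs) b = a ∷ route x xs b

  toList-route : ∀ a xs b → toList (route a xs b) ≡ a ∷ xs ++ b ∷ []
  toList-route a []       b = refl
  toList-route a (x ∷ xs) b = cong (a ∷_) (toList-route x xs b)

  toList-⊕ : (r : Route a b) (s : Route c d) → toList (r ⊕ s) ≡ toList r ++ toList s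
  toList-⊕ ⟨ x ⟩   s = refl
  toList-⊕ (x ∷ r) s = cong (x ∷_) (toList-⊕ r s)

  toList-rev : (r : Route a b) → toList (rev r) ↭ toList r
  toList-rev ⟨ x ⟩   = ↭-refl
  toList-rev (x ∷ r) = ↭-trans (↭-reflexive (toList-⊕ (rev r) ⟨ x ⟩))
    (↭-trans (++-comm (toList (rev r)) _) (prep x (toList-rev r)))

  length-pairs : (r : Route a b) → length (toList r) ≡ suc (length (pairs r))
  length-pairs ⟨ x ⟩   = refl
  length-pairs (x ∷ r) = cong suc (length-pairs r)

  count-sources : ∀ p (r : Route a b) →
    count p (toList r) ≡ count (p ∘ proj₁) (pairs r) + ind (p b)
  count-sources p ⟨ x ⟩   = +-identityʳ _
  count-sources p (x ∷ r) =
    trans (cong (ind (p x) +_) (count-sources p r)) (sym (+-assoc (ind (p x)) _ _))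

  count-targets : ∀ p (r : Route a b) →
    count p (toList r) ≡ ind (p a) + count (p ∘ proj₂) (pairs r)
  count-targets p ⟨ x ⟩   = refl
  count-targets p (x ∷ r) = cong (ind (p x) +_) (count-targets p r)

  split : (r : Route a b) → (s , t) ∈ pairs r →
          Σ[ q ∈ Route a s ] Σ[ q′ ∈ Route t b ] r ≡ q ⊕ q′
  split (x ∷ r) (here refl)  = ⟨ x ⟩ , r , refl
  split (x ∷ r) (there st∈r) =
    let q , q′ , r≡ = split r st∈r in x ∷ q , q′ , cong (x ∷_) r≡

-- Hamilton-connectedness under Ore's condition.

module _ {n : ℕ} (G : Graph n) where
  open Graph G

  private variable
    a b c d s t u v x y z : Fin n

  Path : Route a b → Set
  Path ⟨ x ⟩            = ⊤
  Path (_∷_ x {y} r) = Adj x y × Path r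

  Path-⊕ : (r : Route a b) (s : Route c d) → Path r → Adj b c → Path s → Path (r ⊕ s)
  Path-⊕ ⟨ x ⟩   s _       bc ps = bc , ps
  Path-⊕ (x ∷ ⟨ y ⟩) s (p , pr) bc ps = p , Path-⊕ ⟨ y ⟩ s pr bc ps
  Path-⊕ (x ∷ r@(y ∷ _)) s (p , pr) bc ps = p , Path-⊕ r s pr bc ps

  gap : Fin n → Fin n → ℕ
  gap u v = if adj u v then 0 else 1

  gap-adj : Adj u v → gap u v ≡ 0
  gap-adj {u} {v} uv with adj u v
  ... | true = refl

  gap-nonadj : ¬ Adj u v → gap u v ≡ 1
  gap-nonadj {u} {v} uv with adj u v
  ... | true  = ⊥-elim (uv tt)
  ... | false = refl

  gap-sym : ∀ u v → gap u v ≡ gap v u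
  gap-sym u v with T? (adj u v)
  ... | yes uv = trans (gap-adj uv) (sym (gap-adj (symm uv)))
  ... | no ¬uv = trans (gap-nonadj ¬uv) (sym (gap-nonadj (¬uv ∘ symm)))

  gaps : Route a b → ℕ
  gaps ⟨ x ⟩            = 0
  gaps (_∷_ x {y} r) = gap x y + gaps r

  gaps-⊕ : (r : Route a b) (s : Route c d) → gaps (r ⊕ s) ≡ gaps r + (gap b c + gaps s)
  gaps-⊕ ⟨ x ⟩           s = refl
  gaps-⊕ (x ∷ ⟨ y ⟩)     s = cong (_+ (gap y _ + gaps s)) (sym (+-identityʳ (gap x y)))
  gaps-⊕ (x ∷ r@(y ∷ _)) s = trans (cong (gap x y +_) (gaps-⊕ r s)) (sym (+-assoc (gap x y) _ _))

  gaps-rev : (r : Route a b) → gaps (rev r) ≡ gaps r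
  gaps-rev ⟨ x ⟩   = refl
  gaps-rev (_∷_ x {y} r) = begin
    gaps (rev r ⊕ ⟨ x ⟩)            ≡⟨ gaps-⊕ (rev r) ⟨ x ⟩ ⟩
    gaps (rev r) + (gap y x + 0)    ≡⟨ cong₂ _+_ (gaps-rev r) (+-identityʳ _) ⟩
    gaps r + gap y x                ≡⟨ +-comm (gaps r) _ ⟩
    gap y x + gaps r                ≡⟨ cong (_+ gaps r) (gap-sym y x) ⟩
    gap x y + gaps r                ∎
    where open ≡-Reasoning

  path-or-gap : (r : Route a b) →
    Path r ⊎ ∃₂ λ u v → ¬ Adj u v × Σ[ q ∈ Route a u ] Σ[ q′ ∈ Route v b ] r ≡ q ⊕ q′
  path-or-gap ⟨ x ⟩ = inj₁ tt
  path-or-gap (_∷_ x {y} r) with T? (adj x y)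
  ... | no ¬xy = inj₂ (x , y , ¬xy , ⟨ x ⟩ , r , refl)
  ... | yes xy with path-or-gap r
  ...   | inj₁ p = inj₁ (xy , p)
  ...   | inj₂ (u , v , ¬uv , q , q′ , r≡) = inj₂ (u , v , ¬uv , x ∷ q , q′ , cong (x ∷_) r≡)

  -- Degree sums of at least `length xs + 1`, one more than for a Hamilton cycle: this is Ore's
  -- threshold for Hamilton paths between prescribed ends.
  Ore : List (Fin n) → Set
  Ore xs = ∀ u v → u ∈ xs → v ∈ xs → length xs < count (adj u) xs + count (adj v) xs

  Ore-↭ : ∀ {xs ys} → xs ↭ ys → Ore xs → Ore ys
  Ore-↭ {xs} {ys} p ore u v u∈ v∈ =
    subst₂ _<_ (↭-length p) (cong₂ _+_ (count-↭ (adj u) p) (count-↭ (adj v) p))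
      (ore u v (∈-resp-↭ (↭-sym p) u∈) (∈-resp-↭ (↭-sym p) v∈))

  -- Reversing a block of the route between its two non-adjacent vertices and the
  -- crossing pair (s , t) supplied by the pigeonhole principle trades the steps
  -- uv and st for the edges us and vt.
  flip-left : (q₁ : Route a s) (q₂ : Route t u) (q′ : Route v b) → Adj u s → Adj v t → ¬ Adj u v →
    Σ[ r ∈ Route a b ] toList r ↭ toList ((q₁ ⊕ q₂) ⊕ q′) × gaps r < gaps ((q₁ ⊕ q₂) ⊕ q′)
  flip-left {s = s} {t = t} q₁ q₂ q′ us vt ¬uv = q₁ ⊕ (rev q₂ ⊕ q′) , perm , less
    where
    perm : toList (q₁ ⊕ (rev q₂ ⊕ q′)) ↭ toList ((q₁ ⊕ q₂) ⊕ q′)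
    perm = ↭-trans (↭-reflexive (trans (toList-⊕ q₁ _)
                     (cong (toList q₁ ++_) (toList-⊕ (rev q₂) q′))))
           (↭-trans (++⁺ˡ (toList q₁) (++⁺ʳ (toList q′) (toList-rev q₂)))
           (↭-reflexive (sym (trans (toList-⊕ (q₁ ⊕ q₂) q′)
             (trans (cong (_++ toList q′) (toList-⊕ q₁ q₂)) (++-assoc (toList q₁) _ _))))))

    less : gaps (q₁ ⊕ (rev q₂ ⊕ q′)) < gaps ((q₁ ⊕ q₂) ⊕ q′)
    less rewrite gaps-⊕ q₁ (rev q₂ ⊕ q′) | gaps-⊕ (rev q₂) q′ | gaps-⊕ (q₁ ⊕ q₂) q′ | gaps-⊕ q₁ q₂
      | gaps-rev q₂ | gap-adj (symm us) | gap-adj (symm vt) | gap-nonadj ¬uv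
      | +-suc (gaps q₁ + (gap (s) (t) + gaps q₂)) (gaps q′)
      | sym (+-assoc (gaps q₁) (gaps q₂) (gaps q′))
      = s≤s (+-monoˡ-≤ (gaps q′) (+-monoʳ-≤ (gaps q₁) (m≤n+m (gaps q₂) _)))

  flip-right : (q : Route a u) (q₁ : Route v s) (q₂ : Route t b) → Adj u s → Adj v t → ¬ Adj u v →
    Σ[ r ∈ Route a b ] toList r ↭ toList (q ⊕ (q₁ ⊕ q₂)) × gaps r < gaps (q ⊕ (q₁ ⊕ q₂))
  flip-right q q₁ q₂ us vt ¬uv = q ⊕ (rev q₁ ⊕ q₂) , perm , less
    where
    perm : toList (q ⊕ (rev q₁ ⊕ q₂)) ↭ toList (q ⊕ (q₁ ⊕ q₂))
    perm = ↭-trans (↭-reflexive (trans (toList-⊕ q _)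
                     (cong (toList q ++_) (toList-⊕ (rev q₁) q₂))))
           (↭-trans (++⁺ˡ (toList q) (++⁺ʳ (toList q₂) (toList-rev q₁)))
           (↭-reflexive (sym (trans (toList-⊕ q _) (cong (toList q ++_) (toList-⊕ q₁ q₂))))))

    less : gaps (q ⊕ (rev q₁ ⊕ q₂)) < gaps (q ⊕ (q₁ ⊕ q₂))
    less rewrite gaps-⊕ q (rev q₁ ⊕ q₂) | gaps-⊕ (rev q₁) q₂ | gaps-⊕ q (q₁ ⊕ q₂) | gaps-⊕ q₁ q₂
      | gaps-rev q₁ | gap-adj us | gap-adj vt | gap-nonadj ¬uv
      = +-monoʳ-< (gaps q) (s≤s (+-monoʳ-≤ (gaps q₁) (m≤n+m (gaps q₂) _)))

  -- The steps other than `uv` number two fewer than the vertices. Their sources are all entries but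
  -- the final `u`, which is not adjacent to itself, and `b`; their targets are all but `a` and `v`.
  -- So each of the two counts loses at most one neighbour, and Ore's bound forces a step `st` with
  -- both `us` and `vt` edges.
  fewer-gaps : (q : Route a u) (q′ : Route v b) → ¬ Adj u v → Ore (toList (q ⊕ q′)) →
    Σ[ r ∈ Route a b ] toList r ↭ toList (q ⊕ q′) × gaps r < gaps (q ⊕ q′)
  fewer-gaps {a} {u} {v} {b} q q′ ¬uv ore = reroute (∈-++⁻ (pairs q) st∈)
    where
    ind-loop : ∀ x → ind (adj x x) ≡ 0
    ind-loop x = ¬T⇒ind≡0 loopless

    su su′ tv tv′ : ℕ
    su  = count (adj u ∘ proj₁) (pairs q)
    su′ = count (adj u ∘ proj₁) (pairs q′)
    tv  = count (adj v ∘ proj₂) (pairs q)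
    tv′ = count (adj v ∘ proj₂) (pairs q′)

    count-u : count (adj u) (toList (q ⊕ q′)) ≤ suc (su + su′)
    count-u = begin
      count (adj u) (toList (q ⊕ q′))                   ≡⟨ cong (count (adj u)) (toList-⊕ q q′) ⟩
      count (adj u) (toList q ++ toList q′)             ≡⟨ count-++ (adj u) (toList q) _ ⟩
      count (adj u) (toList q) + count (adj u) (toList q′)
        ≡⟨ cong₂ _+_ (count-sources (adj u) q) (count-sources (adj u) q′) ⟩
      (su + ind (adj u u)) + (su′ + ind (adj u b))
        ≡⟨ cong (λ k → (su + k) + (su′ + ind (adj u b))) (ind-loop u) ⟩
      (su + 0) + (su′ + ind (adj u b))
        ≤⟨ +-monoʳ-≤ (su + 0) (+-monoʳ-≤ su′ (ind≤1 (adj u _))) ⟩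
      (su + 0) + (su′ + 1)
        ≡⟨ solve 2 (λ x y → (x :+ con 0) :+ (y :+ con 1) := con 1 :+ (x :+ y)) refl su su′ ⟩
      suc (su + su′)                                    ∎
      where
      open ≤-Reasoning
      open +-*-Solver

    count-v : count (adj v) (toList (q ⊕ q′)) ≤ suc (tv + tv′)
    count-v = begin
      count (adj v) (toList (q ⊕ q′))                   ≡⟨ cong (count (adj v)) (toList-⊕ q q′) ⟩
      count (adj v) (toList q ++ toList q′)             ≡⟨ count-++ (adj v) (toList q) _ ⟩
      count (adj v) (toList q) + count (adj v) (toList q′)
        ≡⟨ cong₂ _+_ (count-targets (adj v) q) (count-targets (adj v) q′) ⟩
      (ind (adj v a) + tv) + (ind (adj v v) + tv′)
        ≡⟨ cong (λ k → (ind (adj v a) + tv) + (k + tv′)) (ind-loop v) ⟩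
      (ind (adj v a) + tv) + tv′
        ≤⟨ +-monoˡ-≤ tv′ (+-monoˡ-≤ tv (ind≤1 (adj v _))) ⟩
      suc (tv + tv′)                                    ∎
      where open ≤-Reasoning

    length-pairs-⊕ : length (toList (q ⊕ q′)) ≡ 2 + length (pairs q ++ pairs q′)
    length-pairs-⊕ = begin
      length (toList (q ⊕ q′))                    ≡⟨ cong length (toList-⊕ q q′) ⟩
      length (toList q ++ toList q′)              ≡⟨ length-++ (toList q) ⟩
      length (toList q) + length (toList q′)      ≡⟨ cong₂ _+_ (length-pairs q) (length-pairs q′) ⟩
      suc (length (pairs q)) + suc (length (pairs q′))  ≡⟨ +-suc (suc (length (pairs q))) _ ⟩
      2 + (length (pairs q) + length (pairs q′))  ≡⟨ cong (2 +_) (sym (length-++ (pairs q))) ⟩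
      2 + length (pairs q ++ pairs q′)            ∎
      where open ≡-Reasoning

    u∈ : u ∈ toList (q ⊕ q′)
    u∈ = subst (u ∈_) (sym (toList-⊕ q q′)) (∈-++⁺ˡ (last∈ q))

    v∈ : v ∈ toList (q ⊕ q′)
    v∈ = subst (v ∈_) (sym (toList-⊕ q q′)) (∈-++⁺ʳ (toList q) (head∈ q′))

    many : length (pairs q ++ pairs q′) <
           count (adj u ∘ proj₁) (pairs q ++ pairs q′) + count (adj v ∘ proj₂) (pairs q ++ pairs q′)
    many = ≤-pred (≤-pred (begin
      suc (2 + length (pairs q ++ pairs q′))          ≡⟨ cong suc (sym length-pairs-⊕) ⟩
      suc (length (toList (q ⊕ q′)))                  ≤⟨ ore u v u∈ v∈ ⟩
      count (adj u) (toList (q ⊕ q′)) + count (adj v) (toList (q ⊕ q′))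
                                                      ≤⟨ +-mono-≤ count-u count-v ⟩
      suc (su + su′) + suc (tv + tv′)                 ≡⟨ +-suc (suc (su + su′)) _ ⟩
      2 + ((su + su′) + (tv + tv′))
        ≡⟨ sym (cong (2 +_) (cong₂ _+_ (count-++ (adj u ∘ proj₁) (pairs q) (pairs q′))
                                       (count-++ (adj v ∘ proj₂) (pairs q) (pairs q′)))) ⟩
      2 + (count (adj u ∘ proj₁) (pairs q ++ pairs q′) + count (adj v ∘ proj₂) (pairs q ++ pairs q′)) ∎))
      where open ≤-Reasoning

    crossing = pigeonhole (adj u ∘ proj₁) (adj v ∘ proj₂) (pairs q ++ pairs q′) many
    st = proj₁ crossing
    st∈ = proj₁ (proj₂ crossing)
    us = proj₁ (proj₂ (proj₂ crossing))
    vt = proj₂ (proj₂ (proj₂ crossing))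

    reroute : st ∈ pairs q ⊎ st ∈ pairs q′ →
      Σ[ r ∈ Route _ _ ] toList r ↭ toList (q ⊕ q′) × gaps r < gaps (q ⊕ q′)
    reroute (inj₁ st∈q) =
      let q₁ , q₂ , q≡ = split q st∈q
      in subst (λ q → Σ[ r ∈ Route _ _ ] toList r ↭ toList (q ⊕ q′) × gaps r < gaps (q ⊕ q′))
           (sym q≡) (flip-left q₁ q₂ q′ us vt ¬uv)
    reroute (inj₂ st∈q′) =
      let q₁ , q₂ , q≡ = split q′ st∈q′
      in subst (λ q′ → Σ[ r ∈ Route _ _ ] toList r ↭ toList (q ⊕ q′) × gaps r < gaps (q ⊕ q′))
           (sym q≡) (flip-right q q₁ q₂ us vt ¬uv)

  -- Descent on the number of non-adjacent steps; each rerouting permutes the vertices, and Ore's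
  -- condition is invariant under permutation.
  hamiltonian-connected : (r : Route a b) → Ore (toList r) →
    Σ[ r′ ∈ Route a b ] Path r′ × toList r′ ↭ toList r
  hamiltonian-connected {a} {b} r ore = descend r ore (<-wellFounded (gaps r))
    where
    descend : (r : Route a b) → Ore (toList r) → Acc _<_ (gaps r) →
              Σ[ r′ ∈ Route a b ] Path r′ × toList r′ ↭ toList r
    descend r ore (acc rec) with path-or-gap r
    ... | inj₁ p = r , p , ↭-refl
    ... | inj₂ (u , v , ¬uv , q , q′ , refl) =
      let r₁ , r₁↭ , r₁< = fewer-gaps q q′ ¬uv ore
          r₂ , p , r₂↭   = descend r₁ (Ore-↭ (↭-sym r₁↭) ore) (rec r₁<)
      in r₂ , p , ↭-trans r₂↭ r₁↭

-- Weights of routes over 𝔽₂ and switching by a potential.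

infixl 6 _⊞_

-- The computations with closed walks share one pattern: the solver rewrites the goal as a sum of
-- blocks, and `⊞` collects the proofs that the blocks vanish.
_⊞_ : ∀ {a b} → a ≡ false → b ≡ false → a xor b ≡ false
refl ⊞ q = q

≡⇒xor : ∀ {a b} → a ≡ b → a xor b ≡ false
≡⇒xor {a} refl = xor-same a

xor⇒≡ : ∀ a b → a xor b ≡ false → a ≡ b
xor⇒≡ false b     h = sym h
xor⇒≡ true  true  h = refl

odd : ℕ → Bool
odd zero    = false
odd (suc n) = not (odd n)

odd-double : ∀ m → odd (m + m) ≡ false
odd-double zero = refl
odd-double (suc m) rewrite +-suc m m = trans (not-involutive _) (odd-double m)

Unique-++-disjoint : ∀ {A : Set} (xs : List A) {ys z} → Unique (xs ++ ys) → z ∈ ys → z ∉ xs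
Unique-++-disjoint (x ∷ xs) (x≢ ∷ u) z∈ys (here refl)  = All.lookup x≢ (∈-++⁺ʳ xs z∈ys) refl
Unique-++-disjoint (x ∷ xs) (x≢ ∷ u) z∈ys (there z∈xs) = Unique-++-disjoint xs u z∈ys z∈xs

Unique-resp-↭ : ∀ {A : Set} {xs ys : List A} → xs ↭ ys → Unique xs → Unique ys
Unique-resp-↭ {A} p = PermSetoid.Unique-resp-↭ (setoid A) (↭⇒↭ₛ p)

module _ {A : Set} where

  weight : (A → A → Bool) → ∀ {a b} → Route a b → Bool
  weight w ⟨ x ⟩        = false
  weight w (_∷_ x {y} r) = w x y xor weight w r

  weight-⊕ : ∀ w {a b c d : A} (r : Route a b) (s : Route c d) →
    weight w (r ⊕ s) ≡ weight w r xor (w b c xor weight w s)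
  weight-⊕ w ⟨ x ⟩ s = refl
  weight-⊕ w (_∷_ x {y} r) s =
    trans (cong (w x y xor_) (weight-⊕ w r s))
          (solve 3 (λ p q t → p :+ (q :+ t) := (p :+ q) :+ t) refl (w x y) (weight w r) _)
    where open xor-∧-Solver

module _ {n : ℕ} (G : Graph n) where
  open Graph G

  -- Along a path `f` telescopes to its end values, and `τ` is added once per step.
  weight-switch : ∀ (w w′ : Fin n → Fin n → Bool) τ (f : Fin n → Bool) →
    (∀ {x y} → Adj x y → w′ x y ≡ (τ xor (f x xor f y)) xor w x y) →
    ∀ {a b} (r : Route a b) → Path G r →
    weight w′ r ≡ ((odd (length (pairs r)) ∧ τ) xor (f a xor f b)) xor weight w r
  weight-switch w w′ τ f h {a} ⟨ x ⟩ p = sym (cong (_xor false) (xor-same (f a)))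
  weight-switch w w′ τ f h {a} {b} (_∷_ x {y} r) (xy , p) = begin
    w′ x y xor weight w′ r
      ≡⟨ cong₂ _xor_ (h xy) (weight-switch w w′ τ f h r p) ⟩
    ((τ xor (f x xor f y)) xor w x y) xor (((o ∧ τ) xor (f y xor f b)) xor weight w r)
      ≡⟨ solve 7 (λ t fx fy fb p q o →
           ((t :+ (fx :+ fy)) :+ p) :+ (((o :* t) :+ (fy :+ fb)) :+ q)
           := (((con true :+ o) :* t) :+ (fx :+ fb)) :+ (p :+ q))
           refl τ (f x) (f y) (f b) (w x y) (weight w r) o ⟩
    ((not o ∧ τ) xor (f x xor f b)) xor (w x y xor weight w r) ∎
    where
    open ≡-Reasoning
    open xor-∧-Solver
    o = odd (length (pairs r))

  -- Closing up cancels the end values of `f`, and `τ` is added `n` times, an even number. There are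
  -- two applications: with `w` zero, to a weight given by a potential, and with `τ = true` and `f`
  -- zero, to pass between complementary colour classes.
  even-switch : ∀ {m} → n ≡ m + m → ∀ (w w′ : Fin n → Fin n → Bool) τ (f : Fin n → Bool) →
    (∀ {x y} → Adj x y → w′ x y ≡ (τ xor (f x xor f y)) xor w x y) →
    ∀ {a b} (r : Route a b) → Path G r → Adj b a → toList r ↭ allFin n →
    weight w′ r xor w′ b a ≡ weight w r xor w b a
  even-switch {m} n≡ w w′ τ f h {a} {b} r p ba span = begin
    weight w′ r xor w′ b a
      ≡⟨ cong₂ _xor_ (weight-switch w w′ τ f h r p) (h ba) ⟩
    (((o ∧ τ) xor (f a xor f b)) xor weight w r) xor ((τ xor (f b xor f a)) xor w b a)
      ≡⟨ solve 6 (λ t fa fb p q o →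
           (((o :* t) :+ (fa :+ fb)) :+ q) :+ ((t :+ (fb :+ fa)) :+ p)
           := ((con true :+ o) :* t) :+ (q :+ p))
           refl τ (f a) (f b) (w b a) (weight w r) o ⟩
    (not o ∧ τ) xor (weight w r xor w b a)
      ≡⟨ cong (λ z → (z ∧ τ) xor (weight w r xor w b a)) even ⟩
    weight w r xor w b a ∎
    where
    open ≡-Reasoning
    open xor-∧-Solver
    o = odd (length (pairs r))
    -- A route has one step fewer than vertices, so `not o` is the parity of `n`.
    even : not o ≡ false
    even = trans (cong odd (trans (sym (length-pairs r)) (trans (↭-length span)
             (trans (length-tabulate id) n≡)))) (odd-double m)

-- Weights with the same sum on all Hamilton cycles.

module Uniform {n m : ℕ} (n≡ : n ≡ m + m) (G : Graph n)
  (dense : ∀ v → m + 2 ≤ count (Graph.adj G v) (allFin n))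
  (w : Fin n → Fin n → Bool) (w-sym : ∀ x y → w x y ≡ w y x) (κ : Bool)
  (uniform : ∀ {a b} (r : Route a b) → Path G r → Graph.Adj G b a → toList r ↭ allFin n →
             weight w r xor w b a ≡ κ)
  where
  open Graph G

  Adj⇒≢ : ∀ {x y} → Adj x y → x ≢ y
  Adj⇒≢ xx refl = loopless xx

  extract-vertices : ∀ xs → Unique xs → ∃ λ ys → xs ++ ys ↭ allFin n × (∀ {z} → z ∈ ys → z ∉ xs)
  extract-vertices xs u =
    let ys , p = extract xs u (λ {y} _ → ∈-allFin y)
    in ys , p , Unique-++-disjoint xs (Unique-resp-↭ (↭-sym p) (allFin⁺ n))

  length-split : ∀ {xs ys} → xs ++ ys ↭ allFin n → length xs + length ys ≡ m + m
  length-split {xs} p = trans (sym (length-++ xs)) (trans (↭-length p) (trans (length-tabulate id) n≡))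

  count-split : ∀ {xs ys} v → xs ++ ys ↭ allFin n → m + 2 ≤ count (adj v) xs + count (adj v) ys
  count-split {xs} {ys} v p =
    subst (m + 2 ≤_) (trans (sym (count-↭ (adj v) p)) (count-++ (adj v) xs ys)) (dense v)

  -- Of a degree sum of at least `2m + 4`, `u` loses at most 3 to `xs` and `v` at most `length xs`,
  -- so more than `length ys` remains on the other vertices `ys`. The case `u = v` is allowed and
  -- yields a neighbour of `u`.
  common-neighbour : ∀ u v xs → Unique xs → length xs ≤ 3 → ∃ λ z → Adj u z × Adj v z × z ∉ xs
  common-neighbour u v xs uxs ≤3 =
    let ys , p , ys# = extract-vertices xs uxs
        z , z∈ , uz , vz = pigeonhole (adj u) (adj v) ys (room ys p)
    in z , uz , vz , ys# z∈
    where
    room : ∀ ys → xs ++ ys ↭ allFin n → length ys < count (adj u) ys + count (adj v) ys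
    room ys p = +-cancelˡ-≤ (3 + length xs) _ _ (begin
      3 + length xs + suc (length ys)
        ≡⟨ solve 2 (λ x y → con 3 :+ x :+ (con 1 :+ y) := (x :+ y) :+ con 4) refl (length xs) (length ys) ⟩
      (length xs + length ys) + 4
        ≡⟨ cong (_+ 4) (length-split {xs} p) ⟩
      (m + m) + 4
        ≡⟨ solve 1 (λ m → (m :+ m) :+ con 4 := (m :+ con 2) :+ (m :+ con 2)) refl m ⟩
      (m + 2) + (m + 2)
        ≤⟨ +-mono-≤ (count-split {xs} u p) (count-split {xs} v p) ⟩
      (count (adj u) xs + count (adj u) ys) + (count (adj v) xs + count (adj v) ys)
        ≤⟨ +-mono-≤ (+-monoˡ-≤ _ (≤-trans (count≤length (adj u) xs) ≤3)) (+-monoˡ-≤ _ (count≤length (adj v) xs)) ⟩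
      (3 + count (adj u) ys) + (length xs + count (adj v) ys)
        ≡⟨ solve 3 (λ x a b → (con 3 :+ a) :+ (x :+ b) := con 3 :+ x :+ (a :+ b)) refl
             (length xs) (count (adj u) ys) (count (adj v) ys) ⟩
      3 + length xs + (count (adj u) ys + count (adj v) ys) ∎)
      where
      open ≤-Reasoning
      open +-*-Solver

  -- Two vertices outside `R` keep a degree sum of at least `2m + 4 - 2k` in `G - R`. As
  -- `2k ≤ length R + 3`, this is at least `2m + 1 - length R`, one more than the number of vertices
  -- of `G - R`.
  hamiltonian-path-avoiding : ∀ {a b} R k → Unique (a ∷ b ∷ R) →
    (∀ z → z ∉ R → count (adj z) R ≤ k) → k + k ≤ length R + 3 →
    Σ[ r ∈ Route a b ] Path G r × toList r ++ R ↭ allFin n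
  hamiltonian-path-avoiding {a} {b} R k uabR few k+k≤ =
    let S , p , S# = extract-vertices (a ∷ b ∷ R) uabR
        r₀         = route a S b
        r₀↭        : R ++ toList r₀ ↭ allFin n
        r₀↭        = ↭-trans (start S) p
        r , path , r↭ = hamiltonian-connected G r₀ (ore (toList r₀) r₀↭)
    in r , path , ↭-trans (++-comm (toList r) R) (↭-trans (++⁺ˡ R r↭) r₀↭)
    where
    start : ∀ S → R ++ toList (route a S b) ↭ a ∷ b ∷ R ++ S
    start S = begin
      R ++ toList (route a S b)  ≡⟨ cong (R ++_) (toList-route a S b) ⟩
      R ++ a ∷ S ++ b ∷ []       ↭⟨ shift a R _ ⟩
      a ∷ R ++ S ++ b ∷ []       ↭⟨ prep a (++⁺ˡ R (++-comm S (b ∷ []))) ⟩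
      a ∷ R ++ b ∷ S             ↭⟨ prep a (shift b R S) ⟩
      a ∷ b ∷ R ++ S             ∎
      where open PermutationReasoning

    ore : ∀ S → R ++ S ↭ allFin n → Ore G S
    ore S p u v u∈ v∈ = +-cancelˡ-≤ (3 + length R) _ _ (begin
      3 + length R + suc (length S)
        ≡⟨ solve 2 (λ x y → con 3 :+ x :+ (con 1 :+ y) := (x :+ y) :+ con 4) refl (length R) (length S) ⟩
      (length R + length S) + 4
        ≡⟨ cong (_+ 4) (length-split {R} p) ⟩
      (m + m) + 4
        ≡⟨ solve 1 (λ m → (m :+ m) :+ con 4 := (m :+ con 2) :+ (m :+ con 2)) refl m ⟩
      (m + 2) + (m + 2)
        ≤⟨ +-mono-≤ (count-split {R} u p) (count-split {R} v p) ⟩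
      (count (adj u) R + count (adj u) S) + (count (adj v) R + count (adj v) S)
        ≤⟨ +-mono-≤ (+-monoˡ-≤ _ (few u (S# u∈))) (+-monoˡ-≤ _ (few v (S# v∈))) ⟩
      (k + count (adj u) S) + (k + count (adj v) S)
        ≡⟨ solve 3 (λ k a b → (k :+ a) :+ (k :+ b) := (k :+ k) :+ (a :+ b)) refl k (count (adj u) S) (count (adj v) S) ⟩
      (k + k) + (count (adj u) S + count (adj v) S)
        ≤⟨ +-monoˡ-≤ _ k+k≤ ⟩
      (length R + 3) + (count (adj u) S + count (adj v) S)
        ≡⟨ cong (_+ (count (adj u) S + count (adj v) S)) (+-comm (length R) 3) ⟩
      3 + length R + (count (adj u) S + count (adj v) S) ∎)
      where
      open ≤-Reasoning
      open +-*-Solver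
      S# : ∀ {z} → z ∈ S → z ∉ R
      S# = Unique-++-disjoint R (Unique-resp-↭ (↭-sym p) (allFin⁺ n))

  -- One Hamilton path of the remaining graph from `a` to `b` is closed by `R` and by `R′`. Both
  -- cycles have weight `κ`, and the weight of the shared path cancels.
  exchange : ∀ {a b c d c′ d′} (R : Route c d) (R′ : Route c′ d′) k →
    Unique (a ∷ b ∷ toList R) → toList R′ ↭ toList R →
    (∀ z → z ∉ toList R → count (adj z) (toList R) ≤ k) → k + k ≤ length (toList R) + 3 →
    Adj b c → Path G R → Adj d a → Adj b c′ → Path G R′ → Adj d′ a →
    (w b c xor (weight w R xor w d a)) xor (w b c′ xor (weight w R′ xor w d′ a)) ≡ false
  exchange {a} {b} {c} {d} {c′} {d′} R R′ k u R′↭R few k+k≤ bc pR da bc′ pR′ d′a =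
    let r , p , r↭ = hamiltonian-path-avoiding (toList R) k u few k+k≤
    in trans (solve 7 (λ x p q s p′ q′ s′ →
               (p :+ (q :+ s)) :+ (p′ :+ (q′ :+ s′)) :=
               ((x :+ (p :+ q)) :+ s) :+ ((x :+ (p′ :+ q′)) :+ s′)) refl
               (weight w r) (w b c) (weight w R) (w d a) (w b c′) (weight w R′) (w d′ a))
         (≡⇒xor (trans (cycle r p R bc pR da r↭)
                  (sym (cycle r p R′ bc′ pR′ d′a (↭-trans (++⁺ˡ (toList r) R′↭R) r↭)))))
    where
    open xor-∧-Solver
    cycle : ∀ (r : Route a b) (p : Path G r) {c d} (R : Route c d) → Adj b c → Path G R → Adj d a →
      toList r ++ toList R ↭ allFin n →
      (weight w r xor (w b c xor weight w R)) xor w d a ≡ κ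
    cycle r p {c} {d} R bc pR da span =
      trans (cong (_xor w d a) (sym (weight-⊕ w r R)))
        (uniform (r ⊕ R) (Path-⊕ G r R p bc pR) da (↭-trans (↭-reflexive (toList-⊕ r R)) span))

  -- The solver treats `w x y` and `w y x` as independent variables; these terms account for edges
  -- traversed in opposite directions.
  w-loop : ∀ x y → w x y xor w y x ≡ false
  w-loop x y = ≡⇒xor (w-sym x y)

  -- If opposite vertices coincide, the walk retraces its edges. Otherwise the two exchanged routes
  -- share the edges at `c` and differ exactly in the edges of the square. Here `R` has three
  -- vertices, so the bound `k = 3` is immediate.
  square : ∀ {x a y b} → Adj x a → Adj a y → Adj y b → Adj b x →
    (w x a xor w a y) xor (w y b xor w b x) ≡ false
  square {x} {a} {y} {b} xa ay yb bx with x Fin.≟ y | a Fin.≟ b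
  ... | yes refl | _ = trans
    (solve 4 (λ xa ax xb bx → (xa :+ ax) :+ (xb :+ bx) := (xa :+ ax) :+ (xb :+ bx)) refl
       (w x a) (w a x) (w x b) (w b x))
    (w-loop x a ⊞ w-loop x b)
    where open xor-∧-Solver
  ... | no _ | yes refl = trans
    (solve 4 (λ xa ax ya ay → (xa :+ ay) :+ (ya :+ ax) := (xa :+ ax) :+ (ya :+ ay)) refl
       (w x a) (w a x) (w y a) (w a y))
    (w-loop x a ⊞ w-loop y a)
    where open xor-∧-Solver
  ... | no x≢y | no a≢b =
    let c , xc , yc , c∉ = common-neighbour x y (a ∷ b ∷ []) ((a≢b ∷ []) ∷ [] ∷ []) (s≤s (s≤s z≤n))
        y≢x = ≢-sym x≢y
        c≢a = λ c≡a → c∉ (here c≡a)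
        c≢b = λ c≡b → c∉ (there (here c≡b))
    in trans
      (solve 8 (λ xa ay yb bx by ya xc yc →
         (xa :+ ay) :+ (yb :+ bx) :=
         ((by :+ ((yc :+ (xc :+ con false)) :+ xa)) :+ (bx :+ ((xc :+ (yc :+ con false)) :+ ya))) :+
         ((ya :+ ay) :+ (yb :+ by)))
         refl (w x a) (w a y) (w y b) (w b x) (w b y) (w y a) (w x c) (w y c))
      (subst₂ (λ cx cy →
          (w b y xor ((w y c xor (cx xor false)) xor w x a)) xor
          (w b x xor ((w x c xor (cy xor false)) xor w y a)) ≡ false)
         (w-sym c x) (w-sym c y)
         (exchange (y ∷ c ∷ ⟨ x ⟩) (x ∷ c ∷ ⟨ y ⟩) 3
           ((a≢b ∷ Adj⇒≢ ay ∷ ≢-sym c≢a ∷ ≢-sym (Adj⇒≢ xa) ∷ []) ∷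
            (≢-sym (Adj⇒≢ yb) ∷ ≢-sym c≢b ∷ Adj⇒≢ bx ∷ []) ∷
            (Adj⇒≢ yc ∷ y≢x ∷ []) ∷ (≢-sym (Adj⇒≢ xc) ∷ []) ∷ [] ∷ [])
           (reverse₃ x c y)
           (λ z _ → count≤length (adj z) (y ∷ c ∷ x ∷ [])) ≤-refl
           (symm yb) (yc , symm xc , tt) xa bx (xc , symm yc , tt) (symm ay))
       ⊞ (w-loop y a ⊞ w-loop y b))
    where
    open xor-∧-Solver
    reverse₃ : ∀ (x c y : Fin n) → x ∷ c ∷ y ∷ [] ↭ y ∷ c ∷ x ∷ []
    reverse₃ x c y = toList-rev (y ∷ c ∷ ⟨ x ⟩)

  -- All triangles have the same weight.

  tri : Fin n → Fin n → Fin n → Bool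
  tri x y z = (w x y xor w y z) xor w z x

  tri-flip : ∀ x y z → tri x y z ≡ tri x z y
  tri-flip x y z = xor⇒≡ _ _ (trans
    (solve 6 (λ xy yz zx xz zy yx →
       ((xy :+ yz) :+ zx) :+ ((xz :+ zy) :+ yx) := (xy :+ yx) :+ (yz :+ zy) :+ (zx :+ xz))
       refl (w x y) (w y z) (w z x) (w x z) (w z y) (w y x))
    ((w-loop x y ⊞ w-loop y z) ⊞ w-loop z x))
    where open xor-∧-Solver

  tri-swap : ∀ x y z → tri x y z ≡ tri y x z
  tri-swap x y z = xor⇒≡ _ _ (trans
    (solve 6 (λ xy yz zx xz zy yx →
       ((xy :+ yz) :+ zx) :+ ((yx :+ xz) :+ zy) := (xy :+ yx) :+ (yz :+ zy) :+ (zx :+ xz))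
       refl (w x y) (w y z) (w z x) (w x z) (w z y) (w y x))
    ((w-loop x y ⊞ w-loop y z) ⊞ w-loop z x))
    where open xor-∧-Solver

  -- Two triangles sharing the edge `vb` add up to the closed walk `v a b c`.
  tri-fan : ∀ {v a b c} → Adj v a → Adj a b → Adj b v → Adj b c → Adj c v →
    tri v a b ≡ tri v b c
  tri-fan {v} {a} {b} {c} va ab bv bc cv = xor⇒≡ _ _ (trans
    (solve 6 (λ va ab bv vb bc cv →
       ((va :+ ab) :+ bv) :+ ((vb :+ bc) :+ cv) := ((va :+ ab) :+ (bc :+ cv)) :+ (vb :+ bv))
       refl (w v a) (w a b) (w b v) (w v b) (w b c) (w c v))
    (square va ab bc cv ⊞ w-loop v b))
    where open xor-∧-Solver

  -- The vertex v can be inserted into a Hamilton cycle of G - v through either of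
  -- the edges aa′ and bb′, so it has the same effect in both places.
  tri-at : ∀ {v a a′ b b′} → Adj v a → Adj a a′ → Adj a′ v → Adj v b → Adj b b′ → Adj b′ v →
    tri v a a′ ≡ tri v b b′
  tri-at {v} {a} {a′} {b} {b′} va aa′ a′v vb bb′ b′v
    with any? (λ x → T? (adj x v) ×-dec T? (adj x a′) ×-dec T? (adj x b))
  -- The triangles `v a a′`, `v a′ x`, `v x b`, `v b b′` form a fan around `v`.
  ... | yes (x , xv , xa′ , xb) =
    trans (tri-fan va aa′ a′v (symm xa′) xv)
      (trans (tri-fan (symm a′v) (symm xa′) xv xb (symm vb))
        (tri-fan (symm xv) xb (symm vb) bb′ b′v))
  -- In the first three coincidences the triangles share an edge at `v` and `tri-fan` applies up to
  -- reordering; if `a = b′`, then `a` itself is adjacent to `v`, `a′` and `b`.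
  ... | no ¬x with a Fin.≟ b | a′ Fin.≟ b | a′ Fin.≟ b′ | a Fin.≟ b′
  ...   | yes refl | _ | _ | _ =
    trans (tri-flip v a a′) (tri-fan (symm a′v) (symm aa′) (symm va) bb′ b′v)
  ...   | _ | yes refl | _ | _ = tri-fan va aa′ a′v bb′ b′v
  ...   | _ | _ | yes refl | _ = trans (tri-fan va aa′ a′v (symm bb′) (symm vb)) (tri-flip v a′ b)
  ...   | _ | _ | _ | yes refl = ⊥-elim (¬x (a , symm va , aa′ , symm bb′))
  ...   | no a≢b | no a′≢b | no a′≢b′ | no a≢b′ =
    let z , a′z , bz , z∉ = common-neighbour a′ b (v ∷ a ∷ b′ ∷ [])
          ((Adj⇒≢ va ∷ ≢-sym (Adj⇒≢ b′v) ∷ []) ∷ (a≢b′ ∷ []) ∷ [] ∷ []) ≤-refl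
        v≢z  = λ v≡z → z∉ (here (sym v≡z))
        a≢z  = λ a≡z → z∉ (there (here (sym a≡z)))
        b′≢z = λ b′≡z → z∉ (there (there (here (sym b′≡z))))
    in xor⇒≡ _ _ (trans
      (solve 12 (λ va av aa′ a′v va′ vb bv bb′ b′v vb′ a′z zb →
         ((va :+ aa′) :+ a′v) :+ ((vb :+ bb′) :+ b′v) :=
         ((av :+ ((va′ :+ (a′z :+ (zb :+ con false))) :+ bb′)) :+
          (aa′ :+ ((a′z :+ (zb :+ (bv :+ con false))) :+ vb′))) :+
         ((va :+ av) :+ (a′v :+ va′) :+ (vb :+ bv) :+ (b′v :+ vb′)))
         refl (w v a) (w a v) (w a a′) (w a′ v) (w v a′) (w v b) (w b v) (w b b′) (w b′ v) (w v b′)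
         (w a′ z) (w z b))
      (exchange (v ∷ a′ ∷ z ∷ ⟨ b ⟩) (a′ ∷ z ∷ b ∷ ⟨ v ⟩) 3
         ((≢-sym a≢b′ ∷ Adj⇒≢ b′v ∷ ≢-sym a′≢b′ ∷ b′≢z ∷ ≢-sym (Adj⇒≢ bb′) ∷ []) ∷
          (≢-sym (Adj⇒≢ va) ∷ Adj⇒≢ aa′ ∷ a≢z ∷ a≢b ∷ []) ∷
          (≢-sym (Adj⇒≢ a′v) ∷ v≢z ∷ Adj⇒≢ vb ∷ []) ∷
          (Adj⇒≢ a′z ∷ a′≢b ∷ []) ∷ (≢-sym (Adj⇒≢ bz) ∷ []) ∷ [] ∷ [])
         (++-comm (a′ ∷ z ∷ b ∷ []) (v ∷ [])) few (m≤m+n 6 1)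
         (symm va) (symm a′v , a′z , symm bz , tt) bb′
         aa′ (a′z , symm bz , symm vb , tt) (symm b′v)
       ⊞ (w-loop v a ⊞ w-loop a′ v ⊞ w-loop v b ⊞ w-loop b′ v)))
    where
    open xor-∧-Solver
    -- Every vertex misses one of `v`, `a′`, `b`, so `k = 3` is available for four vertices, and
    -- `3 + 3 ≤ 4 + 3`.
    few : ∀ {z} x → x ∉ v ∷ a′ ∷ z ∷ b ∷ [] → count (adj x) (v ∷ a′ ∷ z ∷ b ∷ []) ≤ 3
    few {z} x _ with T? (adj x v) | T? (adj x a′) | T? (adj x b)
    ... | no ¬xv | _ | _ = ≤-pred (count<length (adj x) (v ∷ a′ ∷ z ∷ b ∷ []) (here refl) ¬xv)
    ... | _ | no ¬xa′ | _ = ≤-pred (count<length (adj x) (v ∷ a′ ∷ z ∷ b ∷ []) (there (here refl)) ¬xa′)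
    ... | _ | _ | no ¬xb =
      ≤-pred (count<length (adj x) (v ∷ a′ ∷ z ∷ b ∷ []) (there (there (there (here refl)))) ¬xb)
    ... | yes xv | yes xa′ | yes xb = ⊥-elim (¬x (x , xv , xa′ , xb))

  -- `tri-at` moves between triangles with a common vertex; the triangles `u z y` and `z v y′` link
  -- the given ones at `u`, then at `z`, then at `v`.
  tri-const : ∀ {u a a′ v b b′} → Adj u a → Adj a a′ → Adj a′ u → Adj v b → Adj b b′ → Adj b′ v →
    tri u a a′ ≡ tri v b b′
  tri-const {u} {a} {a′} {v} {b} {b′} ua aa′ a′u vb bb′ b′v =
    let z , uz , vz , _ = common-neighbour u v [] [] z≤n
        y , uy , zy , _ = common-neighbour u z [] [] z≤n
        y′ , vy′ , zy′ , _ = common-neighbour v z [] [] z≤n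
    in begin
      tri u a a′   ≡⟨ tri-at ua aa′ a′u uz zy (symm uy) ⟩
      tri u z y    ≡⟨ tri-swap u z y ⟩
      tri z u y    ≡⟨ tri-at (symm uz) uy (symm zy) (symm vz) vy′ (symm zy′) ⟩
      tri z v y′   ≡⟨ tri-swap z v y′ ⟩
      tri v z y′   ≡⟨ tri-at vz zy′ (symm vy′) vb bb′ b′v ⟩
      tri v b b′   ∎
    where open ≡-Reasoning

  -- Closed walks of length five.

  pent : Fin n → Fin n → Fin n → Fin n → Fin n → Bool
  pent a b c d e = ((w a b xor w b c) xor (w c d xor w d e)) xor w e a

  -- Meant for vertices two apart on a closed walk of length five: with no such pair near, the walk
  -- is an induced pentagon.
  Near : Fin n → Fin n → Set
  Near x y = x ≡ y ⊎ Adj x y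

  near? : ∀ x y → Dec (Near x y)
  near? x y = (x Fin.≟ y) ⊎-dec T? (adj x y)

  module _ (τ : Bool) (tri-const-τ : ∀ {x y z} → Adj x y → Adj y z → Adj z x → tri x y z ≡ τ) where

    tri-τ : ∀ {x y z} → Adj x y → Adj y z → Adj z x → tri x y z xor τ ≡ false
    tri-τ xy yz zx = ≡⇒xor (tri-const-τ xy yz zx)

    pent-rotate : ∀ a b c d e → pent b c d e a xor τ ≡ false → pent a b c d e xor τ ≡ false
    pent-rotate a b c d e = trans
      (solve 6 (λ ab bc cd de ea τ →
         (((ab :+ bc) :+ (cd :+ de)) :+ ea) :+ τ := (((bc :+ cd) :+ (de :+ ea)) :+ ab) :+ τ)
         refl (w a b) (w b c) (w c d) (w d e) (w e a) τ)
      where open xor-∧-Solver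

    -- If `a = c`, the walk is an edge traversed twice and a triangle; a chord `ac` splits it into
    -- the triangle `a b c` and the square `a c d e`.
    pent-near : ∀ {a b c d e} → Adj a b → Adj b c → Adj c d → Adj d e → Adj e a → Near a c →
      pent a b c d e xor τ ≡ false
    pent-near {a} {b} {c} {d} {e} ab bc cd de ea (inj₁ refl) = trans
      (solve 6 (λ ab ba ad de ea τ →
         (((ab :+ ba) :+ (ad :+ de)) :+ ea) :+ τ := (ab :+ ba) :+ (((ad :+ de) :+ ea) :+ τ))
         refl (w a b) (w b a) (w a d) (w d e) (w e a) τ)
      (w-loop a b ⊞ tri-τ cd de ea)
      where open xor-∧-Solver
    pent-near {a} {b} {c} {d} {e} ab bc cd de ea (inj₂ ac) = trans
      (solve 8 (λ ab bc cd de ea ac ca τ →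
         (((ab :+ bc) :+ (cd :+ de)) :+ ea) :+ τ :=
         (((ab :+ bc) :+ ca) :+ τ) :+ ((ac :+ cd) :+ (de :+ ea)) :+ (ac :+ ca))
         refl (w a b) (w b c) (w c d) (w d e) (w e a) (w a c) (w c a) τ)
      (tri-τ ab bc (symm ac) ⊞ square ac cd de ea ⊞ w-loop a c)
      where open xor-∧-Solver

    -- Around `x` lie the triangles on `ea`, `ab`, `bc` and the square `x c d e`; the total is three
    -- times `τ`, which is `τ`.
    pent-dominated : ∀ {a b c d e x} → Adj a b → Adj b c → Adj c d → Adj d e → Adj e a →
      Adj x a → Adj x b → Adj x c → Adj x e → pent a b c d e xor τ ≡ false
    pent-dominated {a} {b} {c} {d} {e} {x} ab bc cd de ea xa xb xc xe = trans
      (solve 14 (λ ab bc cd de ea xa ax xb bx xc cx xe ex τ →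
         (((ab :+ bc) :+ (cd :+ de)) :+ ea) :+ τ :=
         (((xe :+ ea) :+ ax) :+ τ) :+ (((xa :+ ab) :+ bx) :+ τ) :+ (((xb :+ bc) :+ cx) :+ τ) :+
         ((xc :+ cd) :+ (de :+ ex)) :+
         ((xa :+ ax) :+ (xb :+ bx) :+ (xc :+ cx) :+ (xe :+ ex)))
         refl (w a b) (w b c) (w c d) (w d e) (w e a) (w x a) (w a x) (w x b) (w b x)
         (w x c) (w c x) (w x e) (w e x) τ)
      (tri-τ xe ea (symm xa) ⊞ tri-τ xa ab (symm xb) ⊞ tri-τ xb bc (symm xc) ⊞
       square xc cd de (symm xe) ⊞ (w-loop x a ⊞ w-loop x b ⊞ w-loop x c ⊞ w-loop x e))
      where open xor-∧-Solver

    -- The exchanged routes share `h₁h₂`, `h₃d` and `dh₅`. What is left is the sum of the pentagon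
    -- and the triangle `h₁ h₂ c`, in which their common edge `h₁h₂` cancels.
    pent-induced : ∀ {h₁ h₂ h₃ h₄ h₅} →
      Adj h₁ h₂ → Adj h₂ h₃ → Adj h₃ h₄ → Adj h₄ h₅ → Adj h₅ h₁ →
      ¬ Near h₁ h₃ → ¬ Near h₂ h₄ → ¬ Near h₃ h₅ → ¬ Near h₄ h₁ → ¬ Near h₅ h₂ →
      pent h₁ h₂ h₃ h₄ h₅ xor τ ≡ false
    pent-induced {h₁} {h₂} {h₃} {h₄} {h₅} e₁₂ e₂₃ e₃₄ e₄₅ e₅₁ n₁₃ n₂₄ n₃₅ n₄₁ n₅₂
      with any? (λ x → T? (adj x h₁) ×-dec T? (adj x h₂) ×-dec T? (adj x h₃) ×-dec T? (adj x h₅))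
    ... | yes (x , x₁ , x₂ , x₃ , x₅) = pent-dominated e₁₂ e₂₃ e₃₄ e₄₅ e₅₁ x₁ x₂ x₃ x₅
    ... | no ¬x =
      let c , c₁ , c₂ , c∉ = common-neighbour h₁ h₂ (h₃ ∷ h₄ ∷ h₅ ∷ [])
            ((Adj⇒≢ e₃₄ ∷ (n₃₅ ∘ inj₁) ∷ []) ∷ (Adj⇒≢ e₄₅ ∷ []) ∷ [] ∷ []) ≤-refl
          c≢h₃ = λ eq → c∉ (here eq)
          c≢h₄ = λ eq → c∉ (there (here eq))
          c≢h₅ = λ eq → c∉ (there (there (here eq)))
          d , d₃ , d₅ , d∉ = common-neighbour h₃ h₅ (c ∷ h₄ ∷ []) ((c≢h₄ ∷ []) ∷ [] ∷ []) (m≤m+n 2 1)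
          d≢c  = λ eq → d∉ (here eq)
          d≢h₄ = λ eq → d∉ (there (here eq))
          -- `common-neighbour` avoids at most three vertices, so `h₁` and `h₂` are kept away from
          -- `d` by the missing chords `h₁h₃` and `h₂h₅`.
          d≢h₁ = λ eq → n₁₃ (inj₂ (symm (subst (Adj h₃) eq d₃)))
          d≢h₂ = λ eq → n₅₂ (inj₂ (subst (Adj h₅) eq d₅))
      in trans
        (solve 16 (λ e₁₂ e₂₃ e₃₄ e₄₅ e₅₁ e₂₁ e₃₂ e₄₃ c₁ c₂ c₁′ d₃ d₅ d₃′ d₅′ τ →
           (((e₁₂ :+ e₂₃) :+ (e₃₄ :+ e₄₅)) :+ e₅₁) :+ τ :=
           ((e₄₃ :+ ((d₃ :+ (d₅′ :+ (e₅₁ :+ (e₁₂ :+ con false)))) :+ c₂)) :+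
            (e₄₅ :+ ((d₅ :+ (d₃′ :+ (e₃₂ :+ (e₂₁ :+ con false)))) :+ c₁))) :+
           (((e₁₂ :+ c₂) :+ c₁′) :+ τ) :+
           ((e₁₂ :+ e₂₁) :+ (e₂₃ :+ e₃₂) :+ (e₃₄ :+ e₄₃) :+ (c₁ :+ c₁′) :+ (d₃ :+ d₃′) :+ (d₅ :+ d₅′)))
           refl (w h₁ h₂) (w h₂ h₃) (w h₃ h₄) (w h₄ h₅) (w h₅ h₁) (w h₂ h₁) (w h₃ h₂) (w h₄ h₃)
           (w h₁ c) (w h₂ c) (w c h₁) (w h₃ d) (w h₅ d) (w d h₃) (w d h₅) τ)
        (exchange (h₃ ∷ d ∷ h₅ ∷ h₁ ∷ ⟨ h₂ ⟩) (h₅ ∷ d ∷ h₃ ∷ h₂ ∷ ⟨ h₁ ⟩) 4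
           ((c≢h₄ ∷ c≢h₃ ∷ ≢-sym d≢c ∷ c≢h₅ ∷ ≢-sym (Adj⇒≢ c₁) ∷ ≢-sym (Adj⇒≢ c₂) ∷ []) ∷
            (≢-sym (Adj⇒≢ e₃₄) ∷ ≢-sym d≢h₄ ∷ Adj⇒≢ e₄₅ ∷ (n₄₁ ∘ inj₁) ∷ ≢-sym (n₂₄ ∘ inj₁) ∷ []) ∷
            (Adj⇒≢ d₃ ∷ (n₃₅ ∘ inj₁) ∷ ≢-sym (n₁₃ ∘ inj₁) ∷ ≢-sym (Adj⇒≢ e₂₃) ∷ []) ∷
            (≢-sym (Adj⇒≢ d₅) ∷ d≢h₁ ∷ d≢h₂ ∷ []) ∷
            (Adj⇒≢ e₅₁ ∷ (n₅₂ ∘ inj₁) ∷ []) ∷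
            (Adj⇒≢ e₁₂ ∷ []) ∷ [] ∷ [])
           (++⁺ (toList-rev (h₃ ∷ d ∷ ⟨ h₅ ⟩)) (swap h₂ h₁ ↭-refl)) (few d) ≤-refl
           (symm e₃₄) (d₃ , symm d₅ , e₅₁ , e₁₂ , tt) c₂
           e₄₅ (d₅ , symm d₃ , symm e₂₃ , symm e₁₂ , tt) c₁
         ⊞ tri-τ e₁₂ c₂ (symm c₁)
         ⊞ (w-loop h₁ h₂ ⊞ w-loop h₂ h₃ ⊞ w-loop h₃ h₄ ⊞ w-loop h₁ c ⊞ w-loop h₃ d ⊞ w-loop h₅ d))
      where
      open xor-∧-Solver
      -- One of the five vertices is always missed, which gives `k = 4`, the largest value with
      -- `k + k ≤ 5 + 3`.
      few : ∀ d x → x ∉ h₃ ∷ d ∷ h₅ ∷ h₁ ∷ h₂ ∷ [] → count (adj x) (h₃ ∷ d ∷ h₅ ∷ h₁ ∷ h₂ ∷ []) ≤ 4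
      few d x _ with T? (adj x h₁) | T? (adj x h₂) | T? (adj x h₃) | T? (adj x h₅)
      ... | no ¬x₁ | _ | _ | _ =
        ≤-pred (count<length (adj x) (h₃ ∷ d ∷ h₅ ∷ h₁ ∷ h₂ ∷ []) (there (there (there (here refl)))) ¬x₁)
      ... | _ | no ¬x₂ | _ | _ =
        ≤-pred (count<length (adj x) (h₃ ∷ d ∷ h₅ ∷ h₁ ∷ h₂ ∷ []) (there (there (there (there (here refl))))) ¬x₂)
      ... | _ | _ | no ¬x₃ | _ =
        ≤-pred (count<length (adj x) (h₃ ∷ d ∷ h₅ ∷ h₁ ∷ h₂ ∷ []) (here refl) ¬x₃)
      ... | _ | _ | _ | no ¬x₅ =
        ≤-pred (count<length (adj x) (h₃ ∷ d ∷ h₅ ∷ h₁ ∷ h₂ ∷ []) (there (there (here refl))) ¬x₅)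
      ... | yes x₁ | yes x₂ | yes x₃ | yes x₅ = ⊥-elim (¬x (x , x₁ , x₂ , x₃ , x₅))

    pent-τ : ∀ {a b c d e} → Adj a b → Adj b c → Adj c d → Adj d e → Adj e a →
      pent a b c d e xor τ ≡ false
    pent-τ {a} {b} {c} {d} {e} ab bc cd de ea
      with near? a c | near? b d | near? c e | near? d a | near? e b
    ... | yes p | _ | _ | _ | _ = pent-near ab bc cd de ea p
    ... | _ | yes p | _ | _ | _ = pent-rotate a b c d e (pent-near bc cd de ea ab p)
    ... | _ | _ | yes p | _ | _ =
      pent-rotate a b c d e (pent-rotate b c d e a (pent-near cd de ea ab bc p))
    ... | _ | _ | _ | yes p | _ =
      pent-rotate a b c d e (pent-rotate b c d e a (pent-rotate c d e a b (pent-near de ea ab bc cd p)))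
    ... | _ | _ | _ | _ | yes p =
      pent-rotate a b c d e (pent-rotate b c d e a (pent-rotate c d e a b
        (pent-rotate d e a b c (pent-near ea ab bc cd de p))))
    ... | no p | no q | no r | no s | no t = pent-induced ab bc cd de ea p q r s t

    potential : Fin n → Fin n → Bool
    potential v x = let a , _ = common-neighbour v x [] [] z≤n in w v a xor w a x

    -- The closed walk `v a x y b` has weight `τ`; its vertices may coincide, which `pent-τ`
    -- permits. The trailing `xor false` fits `even-switch` with the zero weight.
    edge-potential : ∀ v {x y} → Adj x y →
      w x y ≡ (τ xor (potential v x xor potential v y)) xor false
    edge-potential v {x} {y} xy =
      let a , va , xa , _ = common-neighbour v x [] [] z≤n
          b , vb , yb , _ = common-neighbour v y [] [] z≤n
      in xor⇒≡ (w x y) _ (trans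
        (solve 8 (λ xy τ va ax vb by yb bv →
           xy :+ ((τ :+ ((va :+ ax) :+ (vb :+ by))) :+ con false) :=
           ((((va :+ ax) :+ (xy :+ yb)) :+ bv) :+ τ) :+ ((vb :+ bv) :+ (yb :+ by)))
           refl (w x y) τ (w v a) (w a x) (w v b) (w b y) (w y b) (w b v))
        (pent-τ va (symm xa) xy yb (symm vb) ⊞ (w-loop v b ⊞ w-loop y b)))
      where open xor-∧-Solver

  weight-false : ∀ {a b : Fin n} (r : Route a b) → weight (λ _ _ → false) r ≡ false
  weight-false ⟨ x ⟩   = refl
  weight-false (x ∷ r) = weight-false r

  -- The triangle `v a b` fixes the value of `τ`. Since `w` comes from a potential, a single
  -- Hamilton cycle then evaluates `κ`.
  uniform⇒even : Fin n → κ ≡ false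
  uniform⇒even v =
    let a , va , _ = common-neighbour v v [] [] z≤n
        b , vb , ab , _ = common-neighbour v a [] [] z≤n
        τ-const = λ {x y z} xy yz zx → tri-const {x} {y} {z} xy yz zx va ab (symm vb)
        -- With `R` empty this is a Hamilton path of `G` itself, closed by the edge `av`.
        r , p , r↭ = hamiltonian-path-avoiding [] 0 ((Adj⇒≢ va ∷ []) ∷ [] ∷ []) (λ _ _ → z≤n) z≤n
        span = ↭-trans (↭-reflexive (sym (++-identityʳ (toList r)))) r↭
    in begin
      κ                       ≡⟨ sym (uniform r p (symm va) span) ⟩
      weight w r xor w a v    ≡⟨ even-switch G {m} n≡ (λ _ _ → false) w (tri v a b) (potential (tri v a b) τ-const v)
                                   (edge-potential (tri v a b) τ-const v) r p (symm va) span ⟩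
      weight (λ _ _ → false) r xor false ≡⟨ cong (_xor false) (weight-false r) ⟩
      false                   ∎
    where open ≡-Reasoning

-- Positions on a closed walk and sums modulo 2.

module _ {A : Set} where

  -- The closed walk starting with the vertices of the route; with d the first vertex
  -- of the route, position length (toList r) is again the first vertex.
  at : A → ∀ {a b} → Route a b → ℕ → A
  at d ⟨ x ⟩   zero    = x
  at d ⟨ x ⟩   (suc k) = d
  at d (x ∷ r) zero    = x
  at d (x ∷ r) (suc k) = at d r k

  at-zero : ∀ d {a b} (r : Route a b) → at d r 0 ≡ a
  at-zero d ⟨ x ⟩   = refl
  at-zero d (x ∷ r) = refl

  at-length : ∀ d {a b} (r : Route a b) → at d r (length (toList r)) ≡ d
  at-length d ⟨ x ⟩   = refl
  at-length d (x ∷ r) = at-length d r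

  at-∈ : ∀ d {a b} (r : Route a b) {k} → k < length (toList r) → at d r k ∈ toList r
  at-∈ d ⟨ x ⟩   {zero}  k<       = here refl
  at-∈ d ⟨ x ⟩   {suc k} (s≤s ())
  at-∈ d (x ∷ r) {zero}  k<       = here refl
  at-∈ d (x ∷ r) {suc k} (s≤s k<) = there (at-∈ d r k<)

  at-injective : ∀ d {a b} (r : Route a b) → Unique (toList r) → ∀ {j k} →
    j < length (toList r) → k < length (toList r) → at d r j ≡ at d r k → j ≡ k
  at-injective d ⟨ x ⟩   u        {zero}  {zero}  j<       k<       eq = refl
  at-injective d ⟨ x ⟩   u        {zero}  {suc k} j<       (s≤s ()) eq
  at-injective d ⟨ x ⟩   u        {suc j} {k}     (s≤s ()) k<       eq
  at-injective d (x ∷ r) (x≢ ∷ u) {zero}  {zero}  j<       k<       eq = refl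
  at-injective d (x ∷ r) (x≢ ∷ u) {zero}  {suc k} j<       (s≤s k<) eq =
    ⊥-elim (All.lookup x≢ (at-∈ d r k<) eq)
  at-injective d (x ∷ r) (x≢ ∷ u) {suc j} {zero}  (s≤s j<) k<       eq =
    ⊥-elim (All.lookup x≢ (at-∈ d r j<) (sym eq))
  at-injective d (x ∷ r) (x≢ ∷ u) {suc j} {suc k} (s≤s j<) (s≤s k<) eq =
    cong suc (at-injective d r u j< k< eq)

  ⨁ : (A → Bool) → List A → Bool
  ⨁ f []       = false
  ⨁ f (x ∷ xs) = f x xor ⨁ f xs

  ⨁-++ : ∀ f xs ys → ⨁ f (xs ++ ys) ≡ ⨁ f xs xor ⨁ f ys
  ⨁-++ f []       ys = refl
  ⨁-++ f (x ∷ xs) ys = trans (cong (f x xor_) (⨁-++ f xs ys))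
    (solve 3 (λ a b c → a :+ (b :+ c) := (a :+ b) :+ c) refl (f x) (⨁ f xs) (⨁ f ys))
    where open xor-∧-Solver

⨁-map : ∀ {A B : Set} (f : B → Bool) (g : A → B) xs → ⨁ f (map g xs) ≡ ⨁ (f ∘ g) xs
⨁-map f g []       = refl
⨁-map f g (x ∷ xs) = cong (f (g x) xor_) (⨁-map f g xs)

⨁-cartesianProduct : ∀ {A B : Set} (f : A × B → Bool) xs ys →
  ⨁ f (cartesianProduct xs ys) ≡ ⨁ (λ x → ⨁ (λ y → f (x , y)) ys) xs
⨁-cartesianProduct f []       ys = refl
⨁-cartesianProduct f (x ∷ xs) ys = trans (⨁-++ f (map (x ,_) ys) _)
  (cong₂ _xor_ (⨁-map f (x ,_) ys) (⨁-cartesianProduct f xs ys))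

-- The shape is that of `occurrences`, a filter on the `mapMaybe` defining `edges`; its parity
-- becomes a sum over all ordered pairs.
odd-length-filter : ∀ {A B : Set} {P : B → Set} (P? : Decidable P) (F : A → Maybe B) (f : A → Bool) →
  (∀ x → maybe′ (λ e → does (P? e)) false (F x) ≡ f x) →
  ∀ xs → odd (length (filter P? (mapMaybe F xs))) ≡ ⨁ f xs
odd-length-filter P? F f h []       = refl
odd-length-filter P? F f h (x ∷ xs) with F x | h x
... | nothing | eq = trans (odd-length-filter P? F f h xs) (cong (_xor ⨁ f xs) eq)
... | just e  | eq with does (P? e)
...   | true  = trans (cong not (odd-length-filter P? F f h xs)) (cong (_xor ⨁ f xs) eq)
...   | false = trans (odd-length-filter P? F f h xs) (cong (_xor ⨁ f xs) eq)

⨁< : ℕ → (ℕ → Bool) → Bool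
⨁< zero    f = false
⨁< (suc n) f = f 0 xor ⨁< n (f ∘ suc)

⨁-tabulate : ∀ {A : Set} n (h : Fin n → A) f g → (∀ i → f (h i) ≡ g (toℕ i)) →
  ⨁ f (tabulate h) ≡ ⨁< n g
⨁-tabulate zero    h f g eq = refl
⨁-tabulate (suc n) h f g eq = cong₂ _xor_ (eq zero) (⨁-tabulate n (h ∘ suc) f (g ∘ suc) (eq ∘ suc))

⨁<-cong : ∀ n {f g} → (∀ k → f k ≡ g k) → ⨁< n f ≡ ⨁< n g
⨁<-cong zero    eq = refl
⨁<-cong (suc n) eq = cong₂ _xor_ (eq 0) (⨁<-cong n (eq ∘ suc))

⨁<-xor : ∀ n (f g : ℕ → Bool) → ⨁< n (λ k → f k xor g k) ≡ ⨁< n f xor ⨁< n g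
⨁<-xor zero    f g = refl
⨁<-xor (suc n) f g = trans (cong ((f 0 xor g 0) xor_) (⨁<-xor n (f ∘ suc) (g ∘ suc)))
  (solve 4 (λ a b c d → (a :+ b) :+ (c :+ d) := (a :+ c) :+ (b :+ d)) refl
    (f 0) (g 0) (⨁< n (f ∘ suc)) (⨁< n (g ∘ suc)))
  where open xor-∧-Solver

⨁<-false : ∀ n → ⨁< n (λ _ → false) ≡ false
⨁<-false zero    = refl
⨁<-false (suc n) = ⨁<-false n

⨁<-∧ : ∀ n b (f : ℕ → Bool) → ⨁< n (λ k → b ∧ f k) ≡ b ∧ ⨁< n f
⨁<-∧ n true  f = refl
⨁<-∧ n false f = ⨁<-false n

⨁<-δ : ∀ n k (f : ℕ → Bool) → ⨁< n (λ j → (j ≡ᵇ k) ∧ f j) ≡ (k <ᵇ n) ∧ f k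
⨁<-δ zero    k       f = refl
⨁<-δ (suc n) zero    f = trans (cong (f 0 xor_) (⨁<-false n)) (xor-identityʳ (f 0))
⨁<-δ (suc n) (suc k) f = ⨁<-δ n k (f ∘ suc)

⨁<-init : ∀ n (f : ℕ → Bool) → ⨁< (suc n) (λ k → (k <ᵇ n) ∧ f k) ≡ ⨁< n f
⨁<-init zero    f = refl
⨁<-init (suc n) f = cong (f 0 xor_) (⨁<-init n (f ∘ suc))

⨁<-last : ∀ n (f : ℕ → Bool) → ⨁< (suc n) f ≡ ⨁< n f xor f n
⨁<-last zero    f = xor-identityʳ (f 0)
⨁<-last (suc n) f = trans (cong (f 0 xor_) (⨁<-last n (f ∘ suc)))
  (solve 3 (λ a b c → a :+ (b :+ c) := (a :+ b) :+ c) refl (f 0) (⨁< n (f ∘ suc)) (f (suc n)))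
  where open xor-∧-Solver

-- The entries of the upper triangle of the adjacency matrix of the cycle, the entry
-- in position (i , i + 1) weighted by f i and the one in the corner by f (n - 1).
cycle-entry : ℕ → (ℕ → Bool) → ℕ → ℕ → Bool
cycle-entry n f i j = ((j ≡ᵇ suc i) ∧ f i) xor (((i ≡ᵇ 0) ∧ (suc j ≡ᵇ n)) ∧ f j)

-- Each row but the last meets the superdiagonal in `f i`; the corner, in row 0, supplies the
-- missing `f (n - 1)`.
⨁<-cycle-entry : ∀ n f → ⨁< n (λ i → ⨁< n (cycle-entry n f i)) ≡ ⨁< n f
⨁<-cycle-entry zero    f = refl
⨁<-cycle-entry (suc p) f = begin
  ⨁< (suc p) (λ i → ⨁< (suc p) (cycle-entry (suc p) f i))
    ≡⟨ ⨁<-cong (suc p) row ⟩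
  ⨁< (suc p) (λ i → ((i <ᵇ p) ∧ f i) xor ((i ≡ᵇ 0) ∧ f p))
    ≡⟨ ⨁<-xor (suc p) (λ i → (i <ᵇ p) ∧ f i) (λ i → (i ≡ᵇ 0) ∧ f p) ⟩
  ⨁< (suc p) (λ i → (i <ᵇ p) ∧ f i) xor ⨁< (suc p) (λ i → (i ≡ᵇ 0) ∧ f p)
    ≡⟨ cong₂ _xor_ (⨁<-init p f) corner ⟩
  ⨁< p f xor f p
    ≡⟨ sym (⨁<-last p f) ⟩
  ⨁< (suc p) f ∎
  where
  open ≡-Reasoning

  corner : ⨁< (suc p) (λ i → (i ≡ᵇ 0) ∧ f p) ≡ f p
  corner = ⨁<-δ (suc p) 0 (λ _ → f p)

  superdiagonal : ∀ i → ⨁< (suc p) (λ j → (j ≡ᵇ suc i) ∧ f i) ≡ (i <ᵇ p) ∧ f i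
  superdiagonal i = ⨁<-δ (suc p) (suc i) (λ _ → f i)

  last-row : ∀ i → ⨁< (suc p) (λ j → ((i ≡ᵇ 0) ∧ (j ≡ᵇ p)) ∧ f j) ≡ (i ≡ᵇ 0) ∧ f p
  last-row i = begin
    ⨁< (suc p) (λ j → ((i ≡ᵇ 0) ∧ (j ≡ᵇ p)) ∧ f j)
      ≡⟨ ⨁<-cong (suc p) (λ j → ∧-assoc (i ≡ᵇ 0) (j ≡ᵇ p) (f j)) ⟩
    ⨁< (suc p) (λ j → (i ≡ᵇ 0) ∧ ((j ≡ᵇ p) ∧ f j))
      ≡⟨ ⨁<-∧ (suc p) (i ≡ᵇ 0) (λ j → (j ≡ᵇ p) ∧ f j) ⟩
    (i ≡ᵇ 0) ∧ ⨁< (suc p) (λ j → (j ≡ᵇ p) ∧ f j)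
      ≡⟨ cong ((i ≡ᵇ 0) ∧_) (⨁<-δ (suc p) p f) ⟩
    (i ≡ᵇ 0) ∧ ((p <ᵇ suc p) ∧ f p)
      ≡⟨ cong (λ b → (i ≡ᵇ 0) ∧ (b ∧ f p)) (dec-true (p <? suc p) ≤-refl) ⟩
    (i ≡ᵇ 0) ∧ f p ∎

  row : ∀ i → ⨁< (suc p) (cycle-entry (suc p) f i) ≡ ((i <ᵇ p) ∧ f i) xor ((i ≡ᵇ 0) ∧ f p)
  row i = trans
    (⨁<-xor (suc p) (λ j → (j ≡ᵇ suc i) ∧ f i) (λ j → ((i ≡ᵇ 0) ∧ (j ≡ᵇ p)) ∧ f j))
    (cong₂ _xor_ (superdiagonal i) (last-row i))

∣n-1+n∣≡1 : ∀ n → ∣ n - suc n ∣ ≡ 1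
∣n-1+n∣≡1 zero    = refl
∣n-1+n∣≡1 (suc n) = ∣n-1+n∣≡1 n

∣-∣≡1 : ∀ i j → ∣ i - j ∣ ≡ 1 → j ≡ suc i ⊎ i ≡ suc j
∣-∣≡1 zero    j       eq = inj₁ eq
∣-∣≡1 (suc i) zero    eq = inj₂ eq
∣-∣≡1 (suc i) (suc j) eq with ∣-∣≡1 i j eq
... | inj₁ p = inj₁ (cong suc p)
... | inj₂ p = inj₂ (cong suc p)

suc∣-∣≡n : ∀ {n} i j → i < n → j < n → suc ∣ i - j ∣ ≡ n → (i ≡ 0 × suc j ≡ n) ⊎ (j ≡ 0 × suc i ≡ n)
suc∣-∣≡n zero    j       i< j< eq = inj₁ (refl , eq)
suc∣-∣≡n (suc i) zero    i< j< eq = inj₂ (refl , eq)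
suc∣-∣≡n (suc i) (suc j) i< j< refl =
  ⊥-elim (<-irrefl refl (≤-<-trans (∣m-n∣≤m⊔n i j) (⊔-pres-<m (≤-pred i<) (≤-pred j<))))

even⇒2∣ : ∀ n → odd n ≡ false → 2 ∣ n
even⇒2∣ zero          eq = divides 0 refl
even⇒2∣ (suc (suc n)) eq with even⇒2∣ n (trans (sym (not-involutive (odd n))) eq)
... | divides q refl = divides (suc q) refl

module _ {n : ℕ} (G : Graph n) where
  open Graph G

  at-Adj : ∀ d {a b} (r : Route a b) → Path G r → Adj b d →
    ∀ {k} → k < length (toList r) → Adj (at d r k) (at d r (suc k))
  at-Adj d ⟨ x ⟩   p        bd {zero}  k<       = bd
  at-Adj d ⟨ x ⟩   p        bd {suc k} (s≤s ())
  at-Adj d (x ∷ r) (xy , p) bd {zero}  k<       = subst (Adj x) (sym (at-zero d r)) xy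
  at-Adj d (x ∷ r) (xy , p) bd {suc k} (s≤s k<) = at-Adj d r p bd k<

  weight-at : ∀ (w : Fin n → Fin n → Bool) d {a b} (r : Route a b) →
    weight w r xor w b d ≡ ⨁< (length (toList r)) (λ k → w (at d r k) (at d r (suc k)))
  weight-at w d ⟨ x ⟩ = sym (xor-identityʳ (w x d))
  weight-at w d {b = b} (_∷_ x {y} r) = begin
    (w x y xor weight w r) xor w b d
      ≡⟨ solve 3 (λ p q t → (p :+ q) :+ t := p :+ (q :+ t)) refl (w x y) (weight w r) (w b d) ⟩
    w x y xor (weight w r xor w b d)
      ≡⟨ cong₂ (λ y s → w x y xor s) (sym (at-zero d r)) (weight-at w d r) ⟩
    w x (at d r 0) xor ⨁< (length (toList r)) (λ k → w (at d r k) (at d r (suc k))) ∎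
    where
    open ≡-Reasoning
    open xor-∧-Solver

-- Parity of a colour on a Hamilton cycle.

module _ {n k : ℕ} {G : Graph n} (χ : Coloring G k) where
  open Graph G
  open Coloring χ

  -- Extended by `false` to non-adjacent pairs, to be a weight on all ordered pairs as `Uniform`
  -- expects.
  hasColor : Fin k → Fin n → Fin n → Bool
  hasColor c u v with T? (adj u v)
  ... | yes uv = does (color u v uv Fin.≟ c)
  ... | no _   = false

  hasColor-adj : ∀ c {u v} (uv : Adj u v) → hasColor c u v ≡ does (color u v uv Fin.≟ c)
  hasColor-adj c {u} {v} uv with T? (adj u v)
  ... | yes uv′ = cong (λ p → does (color u v p Fin.≟ c)) (T-irrelevant uv′ uv)
  ... | no ¬uv  = ⊥-elim (¬uv uv)

  hasColor-sym : ∀ c u v → hasColor c u v ≡ hasColor c v u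
  hasColor-sym c u v with T? (adj u v)
  ... | yes uv = trans (cong (λ x → does (x Fin.≟ c)) (color-symm uv (symm uv)))
                       (sym (hasColor-adj c (symm uv)))
  ... | no ¬uv with T? (adj v u)
  ...   | yes vu = ⊥-elim (¬uv (symm vu))
  ...   | no _   = refl

module HamiltonCycle {n : ℕ} (3≤n : 3 ≤ n) {G : Graph n} {a b : Fin n} (r : Route a b)
  (path : Path G r) (ba : Graph.Adj G b a) (span : toList r ↭ allFin n) where
  open Graph G

  length≡ : length (toList r) ≡ n
  length≡ = trans (↭-length span) (length-tabulate id)

  g : ℕ → Fin n
  g = at a r

  g-Adj : ∀ {k} → k < n → Adj (g k) (g (suc k))
  g-Adj k<n = at-Adj G a r path ba (subst (_ <_) (sym length≡) k<n)

  g-closed : g n ≡ g 0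
  g-closed = trans (cong g (sym length≡)) (trans (at-length a r) (sym (at-zero a r)))

  g-closing : ∀ {k} → suc k ≡ n → Adj (g k) (g 0)
  g-closing {k} refl = subst (Adj (g k)) g-closed (g-Adj ≤-refl)

  copy : Copy (C n) G
  copy = record { φ = g ∘ toℕ ; injective = inj ; preserves = λ {i} {j} → pres i j }
    where
    inj : ∀ {i j} → g (toℕ i) ≡ g (toℕ j) → i ≡ j
    inj {i} {j} eq = toℕ-injective (at-injective a r (Unique-resp-↭ (↭-sym span) (allFin⁺ n))
      (subst (toℕ i <_) (sym length≡) (toℕ<n i)) (subst (toℕ j <_) (sym length≡) (toℕ<n j)) eq)

    pres : ∀ i j → Graph.Adj (C n) i j → Adj (g (toℕ i)) (g (toℕ j))
    pres i j ij with toWitness {a? = cycleAdj? i j} ij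
    ... | _ , inj₁ d≡1 with ∣-∣≡1 (toℕ i) (toℕ j) d≡1
    ...   | inj₁ j≡1+i = subst (Adj (g (toℕ i)) ∘ g) (sym j≡1+i) (g-Adj (toℕ<n i))
    ...   | inj₂ i≡1+j = symm (subst (Adj (g (toℕ j)) ∘ g) (sym i≡1+j) (g-Adj (toℕ<n j)))
    pres i j ij | _ , inj₂ d≡n with suc∣-∣≡n (toℕ i) (toℕ j) (toℕ<n i) (toℕ<n j) d≡n
    ...   | inj₁ (i≡0 , 1+j≡n) = symm (subst (Adj (g (toℕ j)) ∘ g) (sym i≡0) (g-closing 1+j≡n))
    ...   | inj₂ (j≡0 , 1+i≡n) = subst (Adj (g (toℕ i)) ∘ g) (sym j≡0) (g-closing 1+i≡n)

  module _ {k} (χ : Coloring G k) (c : Fin k) where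

    -- `W (n - 1)` belongs to the closing edge, since `g n = g 0`.
    W : ℕ → Bool
    W i = hasColor χ c (g i) (g (suc i))

    contribution : Fin n × Fin n → Bool
    contribution (i , j) = does (Graph.isEdge? (C n) (i , j)) ∧ hasColor χ c (g (toℕ i)) (g (toℕ j))

    -- The increasing pairs adjacent in the cycle are `(i , i + 1)` and `(0 , n - 1)`.
    contribution≡entry : ∀ i j → contribution (i , j) ≡ cycle-entry n W (toℕ i) (toℕ j)
    contribution≡entry i j with toℕ j ≟ suc (toℕ i) | (toℕ i ≟ 0) ×-dec (suc (toℕ j) ≟ n)
    -- A pair of both kinds would force `n = 2`.
    ... | yes j≡ | yes (i≡0 , 1+j≡n) =
      ⊥-elim (<-irrefl (trans (cong suc (sym (trans j≡ (cong suc i≡0)))) 1+j≡n) 3≤n)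
    ... | yes j≡ | no ¬corner = begin
      contribution (i , j)                            ≡⟨ cong (_∧ h) (dec-true (Graph.isEdge? (C n) (i , j)) edge) ⟩
      h                                               ≡⟨ cong (hasColor χ c (g (toℕ i)) ∘ g) j≡ ⟩
      W (toℕ i)                                       ≡⟨ sym (xor-identityʳ _) ⟩
      (true ∧ W (toℕ i)) xor (false ∧ W (toℕ j))
        ≡⟨ sym (cong₂ (λ p q → (p ∧ W (toℕ i)) xor (q ∧ W (toℕ j)))
             (dec-true (toℕ j ≟ suc (toℕ i)) j≡)
             (dec-false ((toℕ i ≟ 0) ×-dec (suc (toℕ j) ≟ n)) ¬corner)) ⟩
      cycle-entry n W (toℕ i) (toℕ j)                 ∎
      where
      open ≡-Reasoning
      h = hasColor χ c (g (toℕ i)) (g (toℕ j))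
      i<j : toℕ i < toℕ j
      i<j = subst (toℕ i <_) (sym j≡) ≤-refl
      edge : Graph.IsEdge (C n) (i , j)
      edge = i<j , fromWitness {a? = cycleAdj? i j}
        ((λ i≡j → <⇒≢ i<j (cong toℕ i≡j)) ,
         inj₁ (trans (cong (∣ toℕ i -_∣) j≡) (∣n-1+n∣≡1 (toℕ i))))
    -- `W` records the closing edge as the step from `g j` to `g n = g 0`, so the increasing pair is
    -- reversed.
    ... | no j≢ | yes (i≡0 , 1+j≡n) = begin
      contribution (i , j)                            ≡⟨ cong (_∧ h) (dec-true (Graph.isEdge? (C n) (i , j)) edge) ⟩
      h                                               ≡⟨ hasColor-sym χ c _ _ ⟩
      hasColor χ c (g (toℕ j)) (g (toℕ i))
        ≡⟨ cong (hasColor χ c (g (toℕ j))) (trans (cong g i≡0) (trans (sym g-closed) (cong g (sym 1+j≡n)))) ⟩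
      (false ∧ W (toℕ i)) xor (true ∧ W (toℕ j))
        ≡⟨ sym (cong₂ (λ p q → (p ∧ W (toℕ i)) xor (q ∧ W (toℕ j)))
             (dec-false (toℕ j ≟ suc (toℕ i)) j≢)
             (dec-true ((toℕ i ≟ 0) ×-dec (suc (toℕ j) ≟ n)) (i≡0 , 1+j≡n))) ⟩
      cycle-entry n W (toℕ i) (toℕ j)                 ∎
      where
      open ≡-Reasoning
      h = hasColor χ c (g (toℕ i)) (g (toℕ j))
      i<j : toℕ i < toℕ j
      i<j = subst (_< toℕ j) (sym i≡0) (≤-trans z<s (≤-pred (subst (3 ≤_) (sym 1+j≡n) 3≤n)))
      edge : Graph.IsEdge (C n) (i , j)
      edge = i<j , fromWitness {a? = cycleAdj? i j}
        ((λ i≡j → <⇒≢ i<j (cong toℕ i≡j)) ,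
         inj₂ (trans (cong (λ k → suc ∣ k - toℕ j ∣) i≡0) 1+j≡n))
    ... | no j≢ | no ¬corner = begin
      contribution (i , j)
        ≡⟨ cong (_∧ hasColor χ c (g (toℕ i)) (g (toℕ j))) (dec-false (Graph.isEdge? (C n) (i , j)) ¬edge) ⟩
      false
        ≡⟨ sym (cong₂ (λ p q → (p ∧ W (toℕ i)) xor (q ∧ W (toℕ j)))
             (dec-false (toℕ j ≟ suc (toℕ i)) j≢)
             (dec-false ((toℕ i ≟ 0) ×-dec (suc (toℕ j) ≟ n)) ¬corner)) ⟩
      cycle-entry n W (toℕ i) (toℕ j)                 ∎
      where
      open ≡-Reasoning
      ¬edge : ¬ Graph.IsEdge (C n) (i , j)
      ¬edge (i<j , ij) with toWitness {a? = cycleAdj? i j} ij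
      ... | _ , inj₁ d≡1 with ∣-∣≡1 (toℕ i) (toℕ j) d≡1
      ...   | inj₁ j≡ = j≢ j≡
      ...   | inj₂ i≡ = <-asym i<j (subst (toℕ j <_) (sym i≡) ≤-refl)
      ¬edge (i<j , ij) | _ , inj₂ d≡n with suc∣-∣≡n (toℕ i) (toℕ j) (toℕ<n i) (toℕ<n j) d≡n
      ...   | inj₁ corner    = ¬corner corner
      ...   | inj₂ (j≡0 , _) = n≮0 (subst (toℕ i <_) j≡0 i<j)

    -- Both sides equal the sum of `W` around the cycle; the left one reaches it through the upper
    -- triangle of the adjacency matrix.
    odd-occurrences : odd (Copy.occurrences copy χ c) ≡ weight (hasColor χ c) r xor hasColor χ c b a
    odd-occurrences = begin
      odd (Copy.occurrences copy χ c)
        ≡⟨ odd-length-filter _ _ contribution (λ p → contributes (Graph.isEdge? (C n) p))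
             (cartesianProduct (allFin n) (allFin n)) ⟩
      ⨁ contribution (cartesianProduct (allFin n) (allFin n))
        ≡⟨ ⨁-cartesianProduct contribution (allFin n) (allFin n) ⟩
      ⨁ (λ i → ⨁ (λ j → contribution (i , j)) (allFin n)) (allFin n)
        ≡⟨ ⨁-tabulate n id _ (λ i → ⨁< n (cycle-entry n W i)) (λ i →
             ⨁-tabulate n id _ (cycle-entry n W (toℕ i)) (contribution≡entry i)) ⟩
      ⨁< n (λ i → ⨁< n (cycle-entry n W i))
        ≡⟨ ⨁<-cycle-entry n W ⟩
      ⨁< n W
        ≡⟨ cong (λ l → ⨁< l W) (sym length≡) ⟩
      ⨁< (length (toList r)) W
        ≡⟨ sym (weight-at G (hasColor χ c) a r) ⟩
      weight (hasColor χ c) r xor hasColor χ c b a ∎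
      where
      open ≡-Reasoning
      contributes : ∀ {p} (isEdge : Dec (Graph.IsEdge (C n) p)) →
        maybe′ (λ e → does (Copy.edgeColor copy χ e Fin.≟ c)) false (Maybe.map (p ,_) (dec⇒maybe isEdge)) ≡
        does isEdge ∧ hasColor χ c (g (toℕ (proj₁ p))) (g (toℕ (proj₂ p)))
      contributes (yes (i<j , ij)) = sym (hasColor-adj χ c (Copy.preserves copy ij))
      contributes (no _)           = refl

-- At most two colours do not suffice.

degree≡count : ∀ n (p : Fin n → Bool) → ∣ Vec.tabulate p ∣ ≡ count p (allFin n)
degree≡count n p = go n id
  where
  go : ∀ k (h : Fin k → Fin n) → ∣ Vec.tabulate (p ∘ h) ∣ ≡ count p (tabulate h)
  go zero    h = refl
  go (suc k) h with p (h zero)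
  ... | true  = cong suc (go k (h ∘ suc))
  ... | false = go k (h ∘ suc)

≟-suc-zero : ∀ (x : Fin 2) → does (x Fin.≟ suc zero) ≡ not (does (x Fin.≟ zero))
≟-suc-zero zero       = refl
≟-suc-zero (suc zero) = refl

module TwoColors {n m : ℕ} (n≡ : n ≡ m + m) (3≤n : 3 ≤ n) (G : Graph n) where
  open Graph G

  -- There are `suc k` colours, hence at most two. Two colour classes are complementary, so on a
  -- cycle of even length they have the same parity.
  weight-hasColor : ∀ {k} → k < 2 → (χ : Coloring G (suc k)) → ∀ c {a b} (r : Route a b) →
    Path G r → Adj b a → toList r ↭ allFin n →
    weight (hasColor χ c) r xor hasColor χ c b a ≡
    weight (hasColor χ zero) r xor hasColor χ zero b a
  weight-hasColor         k<2 χ zero       r p ba span = refl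
  weight-hasColor {suc zero} k<2 χ (suc zero) r p ba span =
    even-switch G {m} n≡ (hasColor χ zero) (hasColor χ (suc zero)) true (λ _ → false)
      (λ {x} {y} xy → trans (hasColor-adj χ (suc zero) xy)
        (trans (≟-suc-zero (Coloring.color χ x y xy)) (cong not (sym (hasColor-adj χ zero xy)))))
      r p ba span
  weight-hasColor {suc (suc k)} (s≤s (s≤s ())) χ c r p ba span

  -- A Hamilton cycle with colour `zero` even would have every colour even, against the choice of
  -- `χ`. So all Hamilton cycles have weight `true`, and `uniform⇒even` with `κ = true` gives a
  -- contradiction.
  ¬OddColorable : (∀ v → m + 2 ≤ degree v) → ∀ {k} → k < 2 → ¬ OddColorable G (C n) (suc k)
  ¬OddColorable m+2≤ k<2 (χ , oddColor) =
    case Uniform.uniform⇒even n≡ G dense (hasColor χ zero) (hasColor-sym χ zero) true all-odd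
           (Fin.fromℕ< (≤-trans (s≤s z≤n) 3≤n)) of λ ()
    where
    all-odd : ∀ {a b} (r : Route a b) → Path G r → Adj b a → toList r ↭ allFin n →
      weight (hasColor χ zero) r xor hasColor χ zero b a ≡ true
    all-odd {a} {b} r p ba span with weight (hasColor χ zero) r xor hasColor χ zero b a in eq
    ... | true  = refl
    ... | false =
      let c , ¬even = oddColor (HamiltonCycle.copy 3≤n r p ba span)
      in ⊥-elim (¬even (even⇒2∣ _ (trans (HamiltonCycle.odd-occurrences 3≤n r p ba span χ c)
           (trans (weight-hasColor k<2 χ c r p ba span) eq))))

    dense : ∀ v → m + 2 ≤ count (adj v) (allFin n)
    dense v = subst (m + 2 ≤_) (degree≡count n (adj v)) (m+2≤ v)

δ≤degree : ∀ {n} (G : Graph n) v → Graph.δ G ≤ Graph.degree G v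
δ≤degree {n} G v =
  min≤v⁺ n (map degree (allFin n)) (inj₂ (lose (∈-map⁺ degree (∈-allFin v)) ≤-refl))
  where open Graph G

theorem1p4 : (n : ℕ) → 4 ≤ n → 2 ∣ n →
    (r : ℕ ⁺) → IsMinROdd n (n / 2 + 2) (C n) r → [ 3 ] ≤⁺ r
theorem1p4 n 4≤n 2∣n ⊤⁺ _ = [ 3 ] ≤⊤⁺
-- A finite minimum is attained by some `G` for which that many colours suffice; the value 0 is
-- ruled out by `1 ≤ s` in `IsROdd`.
theorem1p4 n 4≤n (divides m n≡m*2) [ suc k ] ((G , d≤δ , (1≤k , colorable) , _) , _) with k <? 2
... | no k≮2  = [ s≤s (≮⇒≥ k≮2) ]
... | yes k<2 = ⊥-elim (TwoColors.¬OddColorable n≡m+m (≤-trans (n≤1+n 3) 4≤n) G m+2≤degree k<2 colorable)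
  where
  n≡m+m : n ≡ m + m
  n≡m+m = trans n≡m*2 (trans (*-comm m 2) (cong (m +_) (+-identityʳ m)))

  n/2≡m : n / 2 ≡ m
  n/2≡m = trans (cong (_/ 2) n≡m*2) (m*n/n≡m m 2)

  m+2≤degree : ∀ v → m + 2 ≤ Graph.degree G v
  m+2≤degree v = subst (λ h → h + 2 ≤ Graph.degree G v) n/2≡m (≤-trans d≤δ (δ≤degree G v))
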